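{- Let $k\ge 2$ and $n\ge 4k^6$ be integers, and let $\mathcal{F}\subseteq\binom{[n]}{k}$ be an intersecting family. Then the number of triangles in $\mathcal{F}$ is at most $n_{3,k}$, and equality holds if and only if $\mathcal{F}'_{X,k}\subseteq\mathcal{F}\subseteq\mathcal{F}_{X,k}$ for some $3$-subset $X$ of $[n]$.
   Context: $\binom{[n]}{k}$ denotes the family of $k$-element subsets of $[n]=\{1,\dots,n\}$. A family $\mathcal{F}$ is intersecting if $F\cap F'\neq\emptyset$ for all $F,F'\in\mathcal{F}$. A triangle in $\mathcal{F}$ is a set of three members $F,F',F''\in\mathcal{F}$ with $F\cap F'\cap F''=\emptyset$ (in an intersecting family any two of them intersect). For a $3$-subset $X\subseteq[n]$, $\mathcal{F}_{X,k}=\{F\in\binom{[n]}{k}:|F\cap X|\ge 2\}$ and $\mathcal{F}'_{X,k}=\{F\in\binom{[n]}{k}:|F\cap X|=2\}$; $n_{3,k}$ is the number of triangles in $\mathcal{F}_{X,k}$ (independent of the choice of $X$). -}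

module Defs where

open import Data.Bool using (Bool; true; false; _∧_)
open import Data.Nat using (ℕ; zero; suc; _≡ᵇ_; _≤ᵇ_; _≤_; _*_; _^_)
open import Data.Fin using (Fin; toℕ)
open import Data.Fin.Subset using (Subset; _∩_; ∣_∣; Nonempty; Empty)
open import Data.Vec using (Vec; []; _∷_; tabulate)
open import Data.List using (List; []; _∷_; map; _++_; filter; length)
open import Data.Product using (_×_; _,_; Σ)
open import Relation.Binary.PropositionalEquality using (_≡_)
open import Relation.Nullary.Decidable using (does)
open import Relation.Nullary using (Dec)
open import Data.Bool using (T)
open import Data.Bool.Properties using (T?)

Family : ℕ → Set
Family n = Subset n → Bool

_∈F_ : ∀ {n} → Subset n → Family n → Set
A ∈F F = F A ≡ true

IsKUniform : ∀ {n} → ℕ → Family n → Set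
IsKUniform k F = ∀ A → A ∈F F → ∣ A ∣ ≡ k

Intersecting : ∀ {n} → Family n → Set
Intersecting F = ∀ A B → A ∈F F → B ∈F F → Nonempty (A ∩ B)

_⊆F_ : ∀ {n} → Family n → Family n → Set
F ⊆F G = ∀ A → A ∈F F → A ∈F G

allSubsets : (n : ℕ) → List (Subset n)
allSubsets zero = [] ∷ []
allSubsets (suc n) = map (true ∷_) (allSubsets n) ++ map (false ∷_) (allSubsets n)

members : ∀ {n} → Family n → List (Subset n)
members {n} F = filter (λ A → T? (F A)) (allSubsets n)

pairs : ∀ {A : Set} → List A → List (A × A)
pairs [] = []
pairs (x ∷ xs) = map (λ y → x , y) xs ++ pairs xs

triples : ∀ {A : Set} → List A → List (A × A × A)
triples [] = []
triples (x ∷ xs) = map (λ p → x , p) (pairs xs) ++ triples xs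

emptyTriple : ∀ {n} → Subset n × Subset n × Subset n → Bool
emptyTriple (A , B , C) = ∣ A ∩ B ∩ C ∣ ≡ᵇ 0

triangles : ∀ {n} → Family n → ℕ
triangles F = length (filter (λ t → T? (emptyTriple t)) (triples (members F)))

FX : ∀ {n} → Subset n → ℕ → Family n
FX X k A = (∣ A ∣ ≡ᵇ k) ∧ (2 ≤ᵇ ∣ A ∩ X ∣)

F'X : ∀ {n} → Subset n → ℕ → Family n
F'X X k A = (∣ A ∣ ≡ᵇ k) ∧ (∣ A ∩ X ∣ ≡ᵇ 2)

X₀ : (n : ℕ) → Subset n
X₀ n = tabulate (λ i → suc (toℕ i) ≤ᵇ 3)

-- n_{3,k} := number of triangles in 𝓕_{X₀,k}  (for n ≥ 3, |X₀| = 3)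
n3 : ℕ → ℕ → ℕ
n3 n k = triangles (FX (X₀ n) k)

{-# OPTIONS --safe #-}
-- Let d(x,y) be the number of members of 𝓕 through x and y, and call the pair {x,y} heavy if d(x,y) exceeds
-- k·C(n−3,k−3). A member missing both x and y would force d(x,y) ≤ k·C(n−3,k−3), so a heavy pair meets every
-- member of 𝓕. Two disjoint heavy pairs cannot coexist, so the heavy pairs contain a triangle X or form a star.
-- In the first case every member of 𝓕 meets X twice. In the second, or when no pair is heavy, some x is missed by
-- at most k³·C(n−3,k−3) members while (unless a point lies in all members) at most k·C(n−2,k−2) members contain it.
-- Every triangle uses a member missing x, which bounds the number of ordered triangles of 𝓕 strictly below the
-- number of those of 𝓕_{X,k} whose members contain a prescribed pair of points of X each.
-- Equality holds exactly for 𝓕′_{X,k} ⊆ 𝓕 ⊆ 𝓕_{X,k} because the members of triangles of 𝓕_{X,k} are precisely those of 𝓕′_{X,k}.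
module Submission where

open import Defs
open import Data.Bool using (Bool; true; false; _∧_; not; T)
open import Data.Bool.Properties using (T?; T-≡)
import Data.Bool as Bool
open import Data.Fin using (Fin; zero; suc)
open import Data.Fin.Properties using (_≟_; any?)
open import Data.Fin.Subset using (Subset; _∩_; _∪_; ∁; ⁅_⁆; ∣_∣; _⊆_; _∈_; _∉_; Nonempty)
open import Data.Fin.Subset.Properties using (∩-comm; ∩-assoc; ∩-idem; p⊆q⇒∣p∣≤∣q∣; drop-∷-⊆; ∣∁p∣≡n∸∣p∣; x∈⁅x⁆; x∈⁅y⁆⇒x≡y; x∈p∪q⁻; x∈p∪q⁺; x∈p∩q⁺; x∈p∩q⁻; nonempty?; Empty-unique; ∣⊥∣≡0; ∣⁅x⁆∣≡1; anySubset?)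
open import Data.Vec using ([]; _∷_; lookup; here; there; replicate; tabulate)
open import Data.Vec.Properties using (lookup⇒[]=; []=⇒lookup)
open import Data.List using (List; []; _∷_; map; _++_; filter; length)
open import Data.List.Relation.Unary.All using (All; []; _∷_)
open import Data.List.Relation.Unary.All.Properties using (all-filter)
open import Data.Product using (_×_; _,_; Σ; ∃; proj₁; proj₂; uncurry)
open import Data.Sum using (_⊎_; inj₁; inj₂)
open import Function using (_∘_; Equivalence)
open import Function.Bundles using (_⇔_; mk⇔)
open import Relation.Nullary using (¬_; Dec; yes; no; contradiction; ¬?)
open import Relation.Nullary.Decidable using (_×-dec_; decidable-stable)
open import Data.Nat hiding (_≟_)
open import Data.Nat.Properties hiding (_≟_)
open import Data.Nat.Tactic.RingSolver using (solve-∀)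
open import Relation.Binary.PropositionalEquality
open import Algebra.Properties.CommutativeSemigroup +-commutativeSemigroup using (interchange)

private variable
  n : ℕ
  A B : Set

-- Boolean reflection and indicators.

𝟙 : Bool → ℕ
𝟙 true  = 1
𝟙 false = 0

∧-true⁻ : ∀ {a b} → a ∧ b ≡ true → a ≡ true × b ≡ true
∧-true⁻ {true} {true} _ = refl , refl

∧-true⁺ : ∀ {a b} → a ≡ true → b ≡ true → a ∧ b ≡ true
∧-true⁺ refl refl = refl

∧-swap : ∀ a b {c} → a ∧ (b ∧ c) ≡ b ∧ (a ∧ c)
∧-swap true  b     = refl
∧-swap false true  = refl
∧-swap false false = refl

≡ᵇ⁻ : ∀ {a b} → (a ≡ᵇ b) ≡ true → a ≡ b
≡ᵇ⁻ {a} {b} = ≡ᵇ⇒≡ a b ∘ Equivalence.from T-≡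

≡ᵇ⁺ : ∀ {a b} → a ≡ b → (a ≡ᵇ b) ≡ true
≡ᵇ⁺ {a} {b} = Equivalence.to T-≡ ∘ ≡⇒≡ᵇ a b

≤ᵇ⁻ : ∀ {a b} → (a ≤ᵇ b) ≡ true → a ≤ b
≤ᵇ⁻ {a} {b} = ≤ᵇ⇒≤ a b ∘ Equivalence.from T-≡

≤ᵇ⁺ : ∀ {a b} → a ≤ b → (a ≤ᵇ b) ≡ true
≤ᵇ⁺ = Equivalence.to T-≡ ∘ ≤⇒≤ᵇ

𝟙-mono : ∀ {a b} → (a ≡ true → b ≡ true) → 𝟙 a ≤ 𝟙 b
𝟙-mono {false}        _ = z≤n
𝟙-mono {true} {true}  _ = ≤-refl
𝟙-mono {true} {false} h = contradiction (h refl) λ ()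

𝟙-∧ : ∀ a b → 𝟙 (a ∧ b) ≡ 𝟙 a * 𝟙 b
𝟙-∧ true  b = sym (*-identityˡ (𝟙 b))
𝟙-∧ false b = refl

-- Sums over lists

∑ᴸ : (A → ℕ) → List A → ℕ
∑ᴸ f []       = 0
∑ᴸ f (x ∷ xs) = f x + ∑ᴸ f xs

∑ᴸ-++ : (f : A → ℕ) (xs ys : List A) → ∑ᴸ f (xs ++ ys) ≡ ∑ᴸ f xs + ∑ᴸ f ys
∑ᴸ-++ f []       ys = refl
∑ᴸ-++ f (x ∷ xs) ys = trans (cong (f x +_) (∑ᴸ-++ f xs ys)) (sym (+-assoc (f x) _ _))

∑ᴸ-map : (f : B → ℕ) (g : A → B) (xs : List A) → ∑ᴸ f (map g xs) ≡ ∑ᴸ (f ∘ g) xs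
∑ᴸ-map f g []       = refl
∑ᴸ-map f g (x ∷ xs) = cong (f (g x) +_) (∑ᴸ-map f g xs)

∑ᴸ-cong : {f g : A → ℕ} → (∀ x → f x ≡ g x) → ∀ xs → ∑ᴸ f xs ≡ ∑ᴸ g xs
∑ᴸ-cong e []       = refl
∑ᴸ-cong e (x ∷ xs) = cong₂ _+_ (e x) (∑ᴸ-cong e xs)

∑ᴸ-zero : {f : A → ℕ} → (∀ x → f x ≡ 0) → ∀ xs → ∑ᴸ f xs ≡ 0
∑ᴸ-zero e []       = refl
∑ᴸ-zero e (x ∷ xs) = cong₂ _+_ (e x) (∑ᴸ-zero e xs)

∑ᴸ-+ : (f g : A → ℕ) (xs : List A) → ∑ᴸ (λ x → f x + g x) xs ≡ ∑ᴸ f xs + ∑ᴸ g xs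
∑ᴸ-+ f g []       = refl
∑ᴸ-+ f g (x ∷ xs) rewrite ∑ᴸ-+ f g xs = interchange (f x) (g x) (∑ᴸ f xs) (∑ᴸ g xs)

∑ᴸ-filter : (p : A → Bool) (f : A → ℕ) → (∀ x → p x ≡ false → f x ≡ 0) →
  ∀ xs → ∑ᴸ f (filter (λ x → T? (p x)) xs) ≡ ∑ᴸ f xs
∑ᴸ-filter p f h []       = refl
∑ᴸ-filter p f h (x ∷ xs) with p x in eq
... | true  = cong (f x +_) (∑ᴸ-filter p f h xs)
... | false rewrite h x eq = ∑ᴸ-filter p f h xs

length-filter : (p : A → Bool) (xs : List A) →
  length (filter (λ x → T? (p x)) xs) ≡ ∑ᴸ (𝟙 ∘ p) xs
length-filter p []       = refl
length-filter p (x ∷ xs) with p x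
... | true  = cong suc (length-filter p xs)
... | false = length-filter p xs

-- By symmetry each unordered pair of positions is met twice, and the vanishing diagonal removes the
-- repeated ones.
∑ᴸ-square : (g : A → A → ℕ) → (∀ x y → g x y ≡ g y x) → (∀ x → g x x ≡ 0) → ∀ xs →
  ∑ᴸ (λ x → ∑ᴸ (g x) xs) xs ≡ 2 * ∑ᴸ (uncurry g) (pairs xs)
∑ᴸ-square g sy dg []       = refl
∑ᴸ-square g sy dg (x ∷ xs)
  rewrite dg x
        | ∑ᴸ-+ (λ x′ → g x′ x) (λ x′ → ∑ᴸ (g x′) xs) xs
        | ∑ᴸ-square g sy dg xs
        | ∑ᴸ-++ (uncurry g) (map (x ,_) xs) (pairs xs)
        | ∑ᴸ-map (uncurry g) (x ,_) xs
        | ∑ᴸ-cong (λ y → sy y x) xs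
  = double (∑ᴸ (g x) xs) (∑ᴸ (uncurry g) (pairs xs))
  where
  double : ∀ a b → a + (a + 2 * b) ≡ 2 * (a + b)
  double = solve-∀

-- The head of the list can stand in any of the three places, and each choice leaves a square sum
-- over the tail, that is, twice a sum over pairs. Triples using the head more than once vanish by
-- `dg` and symmetry, so `P` gets the factor 3 · 2 = 6.
∑ᴸ-cube : (f : A → A → A → ℕ) →
  (∀ x y z → f x y z ≡ f y x z) → (∀ x y z → f x y z ≡ f x z y) → (∀ x y → f x x y ≡ 0) →
  ∀ xs → ∑ᴸ (λ x → ∑ᴸ (λ y → ∑ᴸ (f x y) xs) xs) xs ≡
         6 * ∑ᴸ (λ (x , y , z) → f x y z) (triples xs)
∑ᴸ-cube f s₁₂ s₂₃ dg [] = refl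
∑ᴸ-cube {A} f s₁₂ s₂₃ dg (x ∷ xs) = begin
  ∑ᴸ (λ y → f x y x + ∑ᴸ (f x y) xs) (x ∷ xs)
    + ∑ᴸ (λ x′ → ∑ᴸ (λ y → f x′ y x + ∑ᴸ (f x′ y) xs) (x ∷ xs)) xs
    ≡⟨ cong₂ _+_ first (∑ᴸ-cong rest xs) ⟩
  D + ∑ᴸ (λ x′ → ∑ᴸ (f x x′) xs + (∑ᴸ (f x x′) xs + ∑ᴸ (λ y → ∑ᴸ (f x′ y) xs) xs)) xs
    ≡⟨ cong (D +_) (trans (∑ᴸ-+ _ _ xs) (cong (D +_) (∑ᴸ-+ _ _ xs))) ⟩
  D + (D + (D + ∑ᴸ (λ x′ → ∑ᴸ (λ y → ∑ᴸ (f x′ y) xs) xs) xs))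
    ≡⟨ cong₂ (λ d t → d + (d + (d + t))) (∑ᴸ-square (f x) (s₂₃ x) dg₂ xs)
         (∑ᴸ-cube f s₁₂ s₂₃ dg xs) ⟩
  2 * P + (2 * P + (2 * P + 6 * t))
    ≡⟨ six P t ⟩
  6 * (P + t)
    ≡⟨ cong (6 *_) (sym (trans (∑ᴸ-++ F (map (x ,_) (pairs xs)) (triples xs))
         (cong (_+ t) (∑ᴸ-map F (x ,_) (pairs xs))))) ⟩
  6 * ∑ᴸ F (triples (x ∷ xs)) ∎
  where
  open ≡-Reasoning
  F : A × A × A → ℕ
  F (x , y , z) = f x y z
  D P t : ℕ
  D = ∑ᴸ (λ y → ∑ᴸ (f x y) xs) xs
  P = ∑ᴸ (uncurry (f x)) (pairs xs)
  t = ∑ᴸ F (triples xs)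
  dg₂ : ∀ y → f x y y ≡ 0
  dg₂ y = trans (s₁₂ x y y) (trans (s₂₃ y x y) (dg y x))
  first : ∑ᴸ (λ y → f x y x + ∑ᴸ (f x y) xs) (x ∷ xs) ≡ D
  first rewrite dg x x | ∑ᴸ-zero (dg x) xs =
    ∑ᴸ-cong (λ y → cong (_+ ∑ᴸ (f x y) xs) (trans (s₂₃ x y x) (dg x y))) xs
  rest : ∀ x′ → ∑ᴸ (λ y → f x′ y x + ∑ᴸ (f x′ y) xs) (x ∷ xs) ≡
                ∑ᴸ (f x x′) xs + (∑ᴸ (f x x′) xs + ∑ᴸ (λ y → ∑ᴸ (f x′ y) xs) xs)
  rest x′ rewrite trans (s₁₂ x′ x x) (trans (s₂₃ x x′ x) (dg x x′))
                | ∑ᴸ-+ (λ y → f x′ y x) (λ y → ∑ᴸ (f x′ y) xs) xs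
                | ∑ᴸ-cong (s₁₂ x′ x) xs
                | ∑ᴸ-cong (λ y → trans (s₂₃ x′ y x) (s₁₂ x′ x y)) xs = refl
  six : ∀ P t → 2 * P + (2 * P + (2 * P + 6 * t)) ≡ 6 * (P + t)
  six = solve-∀

-- Sums over all subsets

-- Recursion on the dimension instead of on `allSubsets` turns counting arguments into inductions
-- over coordinates.
∑ : (Subset n → ℕ) → ℕ
∑ {zero}  f = f []
∑ {suc n} f = ∑ (f ∘ (true ∷_)) + ∑ (f ∘ (false ∷_))

# : Family n → ℕ
# P = ∑ (𝟙 ∘ P)

∑ᴸ-allSubsets : ∀ n (f : Subset n → ℕ) → ∑ᴸ f (allSubsets n) ≡ ∑ f
∑ᴸ-allSubsets zero    f = +-identityʳ _
∑ᴸ-allSubsets (suc n) f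
  rewrite ∑ᴸ-++ f (map (true ∷_) (allSubsets n)) (map (false ∷_) (allSubsets n))
        | ∑ᴸ-map f (true ∷_) (allSubsets n)
        | ∑ᴸ-map f (false ∷_) (allSubsets n)
  = cong₂ _+_ (∑ᴸ-allSubsets n _) (∑ᴸ-allSubsets n _)

∑-mono : {f g : Subset n → ℕ} → (∀ A → f A ≤ g A) → ∑ f ≤ ∑ g
∑-mono {zero}  h = h []
∑-mono {suc n} h = +-mono-≤ (∑-mono (h ∘ (true ∷_))) (∑-mono (h ∘ (false ∷_)))

∑-cong : {f g : Subset n → ℕ} → (∀ A → f A ≡ g A) → ∑ f ≡ ∑ g
∑-cong h = ≤-antisym (∑-mono (≤-reflexive ∘ h)) (∑-mono (≤-reflexive ∘ sym ∘ h))

∑-mono-< : {f g : Subset n → ℕ} → (∀ A → f A ≤ g A) → ∀ A → f A < g A → ∑ f < ∑ g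
∑-mono-< h []          lt = lt
∑-mono-< h (true ∷ A)  lt = +-mono-<-≤ (∑-mono-< (h ∘ (true ∷_)) A lt) (∑-mono (h ∘ (false ∷_)))
∑-mono-< h (false ∷ A) lt = +-mono-≤-< (∑-mono (h ∘ (true ∷_))) (∑-mono-< (h ∘ (false ∷_)) A lt)

∑-+ : (f g : Subset n → ℕ) → ∑ (λ A → f A + g A) ≡ ∑ f + ∑ g
∑-+ {zero}  f g = refl
∑-+ {suc n} f g
  rewrite ∑-+ (f ∘ (true ∷_)) (g ∘ (true ∷_)) | ∑-+ (f ∘ (false ∷_)) (g ∘ (false ∷_))
  = interchange (∑ (f ∘ (true ∷_))) (∑ (g ∘ (true ∷_))) (∑ (f ∘ (false ∷_))) (∑ (g ∘ (false ∷_)))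

∑-*ˡ : ∀ c (f : Subset n → ℕ) → ∑ (λ A → c * f A) ≡ c * ∑ f
∑-*ˡ {zero}  c f = refl
∑-*ˡ {suc n} c f
  rewrite ∑-*ˡ c (f ∘ (true ∷_)) | ∑-*ˡ c (f ∘ (false ∷_))
  = sym (*-distribˡ-+ c _ _)

∑-*ʳ : ∀ c (f : Subset n → ℕ) → ∑ (λ A → f A * c) ≡ ∑ f * c
∑-*ʳ c f = trans (∑-cong (λ A → *-comm (f A) c)) (trans (∑-*ˡ c f) (*-comm c _))

∑-zero : {f : Subset n → ℕ} → (∀ A → f A ≡ 0) → ∑ f ≡ 0
∑-zero {n} h = trans (∑-cong h) (∑-*ˡ {n} 0 (λ _ → 0))

∑³-* : (f g h : Subset n → ℕ) →
  ∑ (λ A → ∑ λ B → ∑ λ C → f A * (g B * h C)) ≡ ∑ f * (∑ g * ∑ h)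
∑³-* {n} f g h = begin
  ∑ (λ A → ∑ λ B → ∑ λ C → f A * (g B * h C))
    ≡⟨ ∑-cong (λ A → ∑-cong λ B → trans (∑-*ˡ {n} (f A) (λ C → g B * h C)) (cong (f A *_) (∑-*ˡ (g B) h))) ⟩
  ∑ (λ A → ∑ λ B → f A * (g B * ∑ h))
    ≡⟨ ∑-cong (λ A → trans (∑-*ˡ {n} (f A) (λ B → g B * ∑ h)) (cong (f A *_) (∑-*ʳ (∑ h) g))) ⟩
  ∑ (λ A → f A * (∑ g * ∑ h))
    ≡⟨ ∑-*ʳ _ f ⟩
  ∑ f * (∑ g * ∑ h) ∎
  where open ≡-Reasoning

#-mono : {P Q : Family n} → P ⊆F Q → # P ≤ # Q
#-mono h = ∑-mono (λ A → 𝟙-mono (h A))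

#-∅ : {P : Family n} → (∀ A → ¬ A ∈F P) → # P ≡ 0
#-∅ {P = P} h = ∑-zero none
  where
  none : ∀ A → 𝟙 (P A) ≡ 0
  none A with P A in eq
  ... | true  = contradiction eq (h A)
  ... | false = refl

infixl 6 _∩F_ _∖F_
_∩F_ _∖F_ : Family n → Family n → Family n
(P ∩F Q) A = P A ∧ Q A
(P ∖F Q) A = P A ∧ not (Q A)

#-split : (P Q : Family n) → # P ≡ # (P ∩F Q) + # (P ∖F Q)
#-split P Q = trans (∑-cong λ A → split (P A) (Q A)) (∑-+ (𝟙 ∘ (P ∩F Q)) (𝟙 ∘ (P ∖F Q)))
  where
  split : ∀ a b → 𝟙 a ≡ 𝟙 (a ∧ b) + 𝟙 (a ∧ not b)
  split true  true  = refl
  split true  false = refl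
  split false _     = refl

-- Indices are peeled off one at a time: what lies in the first `Q` is counted there, and what
-- remains is still covered by the later ones.
#-union-bound : ∀ {m} (P : Family n) (I : Subset m) (Q : Fin m → Family n) {c} →
  (∀ i → lookup I i ≡ true → # (P ∩F Q i) ≤ c) →
  (∀ A → A ∈F P → ∃ λ i → lookup I i ≡ true × A ∈F Q i) → # P ≤ ∣ I ∣ * c
#-union-bound P [] Q bd cov = ≤-reflexive (#-∅ λ A p → none (cov A p))
  where
  none : ∀ {X : Fin 0 → Set} → ¬ ∃ X
  none (() , _)
#-union-bound P (false ∷ I) Q bd cov = #-union-bound P I (Q ∘ suc) (bd ∘ suc) cov′
  where
  cov′ : ∀ A → A ∈F P → ∃ λ i → lookup I i ≡ true × A ∈F Q (suc i)
  cov′ A p with cov A p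
  ... | suc i , q = i , q
#-union-bound {n} P (true ∷ I) Q {c} bd cov = begin
  # P                                  ≡⟨ #-split P (Q zero) ⟩
  # (P ∩F Q zero) + # (P ∖F Q zero)    ≤⟨ +-mono-≤ (bd zero refl)
                                            (#-union-bound (P ∖F Q zero) I (Q ∘ suc) bd′ cov′) ⟩
  c + ∣ I ∣ * c                        ∎
  where
  open ≤-Reasoning
  bd′ : ∀ i → lookup I i ≡ true → # (P ∖F Q zero ∩F Q (suc i)) ≤ c
  bd′ i p = ≤-trans (#-mono weaken) (bd (suc i) p)
    where
    weaken : (P ∖F Q zero ∩F Q (suc i)) ⊆F (P ∩F Q (suc i))
    weaken A q = let u , v = ∧-true⁻ q in ∧-true⁺ (proj₁ (∧-true⁻ {P A} u)) v
  cov′ : ∀ A → A ∈F (P ∖F Q zero) → ∃ λ i → lookup I i ≡ true × A ∈F Q (suc i)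
  cov′ A q with ∧-true⁻ q
  ... | p , nq with cov A p
  ...   | suc i , r = i , r
  ...   | zero , _ , r = contradiction (trans (sym (cong not r)) nq) λ ()

-- Permutations of coordinates

-- Words in adjacent transpositions, where `prep` moves a word one coordinate to the right.
-- Invariance of sizes, intersections and sums then follows by induction on the word.
data Perm : ℕ → Set where
  idₚ   : Perm n
  prep  : Perm n → Perm (suc n)
  swap  : Perm (suc (suc n))
  _then_ : Perm n → Perm n → Perm n

act : Perm n → Subset n → Subset n
act idₚ        A           = A
act (prep p)   (x ∷ A)     = x ∷ act p A
act swap       (x ∷ y ∷ A) = y ∷ x ∷ A
act (p then q) A           = act q (act p A)

inv : Perm n → Perm n
inv idₚ        = idₚ
inv (prep p)   = prep (inv p)
inv swap       = swap
inv (p then q) = inv q then inv p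

act-inv : (p : Perm n) (A : Subset n) → act p (act (inv p) A) ≡ A
act-inv idₚ        A           = refl
act-inv (prep p)   (x ∷ A)     = cong (x ∷_) (act-inv p A)
act-inv swap       (x ∷ y ∷ A) = refl
act-inv (p then q) A           = trans (cong (act q) (act-inv p (act (inv q) A))) (act-inv q A)

act-∩ : (p : Perm n) (A B : Subset n) → act p (A ∩ B) ≡ act p A ∩ act p B
act-∩ idₚ        A           B            = refl
act-∩ (prep p)   (x ∷ A)     (y ∷ B)      = cong (_ ∷_) (act-∩ p A B)
act-∩ swap       (x ∷ y ∷ A) (x′ ∷ y′ ∷ B) = refl
act-∩ (p then q) A           B            = trans (cong (act q) (act-∩ p A B)) (act-∩ q _ _)

∣act∣ : (p : Perm n) (A : Subset n) → ∣ act p A ∣ ≡ ∣ A ∣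
∣act∣ idₚ        A                   = refl
∣act∣ (prep p)   (true ∷ A)          = cong suc (∣act∣ p A)
∣act∣ (prep p)   (false ∷ A)         = ∣act∣ p A
∣act∣ swap       (true ∷ true ∷ A)   = refl
∣act∣ swap       (true ∷ false ∷ A)  = refl
∣act∣ swap       (false ∷ true ∷ A)  = refl
∣act∣ swap       (false ∷ false ∷ A) = refl
∣act∣ (p then q) A                   = trans (∣act∣ q _) (∣act∣ p A)

∑-act : (p : Perm n) (f : Subset n → ℕ) → ∑ (f ∘ act p) ≡ ∑ f
∑-act idₚ        f = refl
∑-act (prep p)   f = cong₂ _+_ (∑-act p (f ∘ (true ∷_))) (∑-act p (f ∘ (false ∷_)))
∑-act {suc (suc n)} swap f =
  interchange (h true true) (h false true) (h true false) (h false false)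
  where
  h : Bool → Bool → ℕ
  h x y = ∑ (λ A → f (x ∷ y ∷ A))
∑-act (p then q) f = trans (∑-act p (f ∘ act q)) (∑-act q f)

-- The normal form of a subset under permutations. Unlike the tabulated `X₀` it is recursive, which
-- suits the induction in `sort`.
firsts : ∀ n → ℕ → Subset n
firsts zero    _       = []
firsts (suc n) zero    = false ∷ firsts n zero
firsts (suc n) (suc s) = true ∷ firsts n s

-- The leading `false` travels past the block of `true` entries by one `swap` per entry.
false∷firsts : ∀ n s → s ≤ n → ∃ λ (p : Perm (suc n)) → act p (false ∷ firsts n s) ≡ firsts (suc n) s
false∷firsts n       zero    _         = idₚ , refl
false∷firsts (suc n) (suc s) (s≤s s≤n) with false∷firsts n s s≤n
... | p , eq = swap then prep p , cong (true ∷_) eq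

∣A∣≤n : (A : Subset n) → ∣ A ∣ ≤ n
∣A∣≤n []          = z≤n
∣A∣≤n (true ∷ A)  = s≤s (∣A∣≤n A)
∣A∣≤n (false ∷ A) = m≤n⇒m≤1+n (∣A∣≤n A)

-- Insertion sort: the tail is sorted first, and then a `false` head is moved behind the ones.
sort : (A : Subset n) → ∃ λ p → act p A ≡ firsts n ∣ A ∣
sort []          = idₚ , refl
sort (true ∷ A)  with sort A
... | p , eq = prep p , cong (true ∷_) eq
sort {suc n} (false ∷ A) with sort A | false∷firsts n ∣ A ∣ (∣A∣≤n A)
... | p , eq | q , eq′ = prep p then q , trans (cong (act q ∘ (false ∷_)) eq) eq′

tabulate-false : ∀ n → tabulate {n = n} (λ _ → false) ≡ firsts n 0
tabulate-false zero    = refl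
tabulate-false (suc n) = cong (false ∷_) (tabulate-false n)

X₀-firsts : ∀ m → X₀ (3 + m) ≡ firsts (3 + m) 3
X₀-firsts m = cong (λ A → true ∷ true ∷ true ∷ A) (tabulate-false m)

-- Binomial coefficients

bin : ℕ → ℕ → ℕ
bin n       zero    = 1
bin zero    (suc k) = 0
bin (suc n) (suc k) = bin n k + bin n (suc k)

-- bin⁻ n k is the binomial coefficient of n over k − 1, which vanishes for k = 0.
bin⁻ : ℕ → ℕ → ℕ
bin⁻ n zero    = 0
bin⁻ n (suc k) = bin n k

bin-suc : ∀ n k → bin (suc n) k ≡ bin⁻ n k + bin n k
bin-suc n zero    = refl
bin-suc n (suc k) = refl

bin>0 : ∀ n k → k ≤ n → 0 < bin n k
bin>0 n       zero    _       = s≤s z≤n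
bin>0 (suc n) (suc k) (s≤s h) = ≤-trans (bin>0 n k h) (m≤m+n _ _)

-- Serves to compare neighbouring binomial coefficients without division. After Pascal's rule,
-- `step₁` regroups the terms so that both instances one row higher apply.
bin-absorb : ∀ n k → suc k * bin (suc n) (suc k) ≡ suc n * bin n k
bin-absorb zero    zero    = refl
bin-absorb zero    (suc k) = *-zeroʳ (2 + k)
bin-absorb (suc n) zero    = begin
  1 * (1 + bin (suc n) 1)  ≡⟨ cong (λ b → 1 * (1 + b)) (trans (sym (*-identityˡ _)) (bin-absorb n 0)) ⟩
  1 * (1 + suc n * 1)      ≡⟨ arith n ⟩
  (2 + n) * 1              ∎
  where
  open ≡-Reasoning
  arith : ∀ n → 1 * (1 + suc n * 1) ≡ (2 + n) * 1
  arith = solve-∀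
bin-absorb (suc n) (suc k) = begin
  (2 + k) * (b + b′)                      ≡⟨ step₁ k b b′ ⟩
  b + (suc k * b + (2 + k) * b′)          ≡⟨ cong (b +_) (cong₂ _+_ (bin-absorb n k) (bin-absorb n (suc k))) ⟩
  b + (suc n * bin n k + suc n * bin n (suc k)) ≡⟨ step₂ n (bin n k) (bin n (suc k)) ⟩
  (2 + n) * b                             ∎
  where
  open ≡-Reasoning
  b b′ : ℕ
  b  = bin (suc n) (suc k)
  b′ = bin (suc n) (2 + k)
  step₁ : ∀ k b b′ → (2 + k) * (b + b′) ≡ b + (suc k * b + (2 + k) * b′)
  step₁ = solve-∀
  step₂ : ∀ n x y → x + y + (suc n * x + suc n * y) ≡ (2 + n) * (x + y)
  step₂ = solve-∀

bin⁻-absorb : ∀ n k → k * bin (suc n) k ≡ suc n * bin⁻ n k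
bin⁻-absorb n zero    = sym (*-zeroʳ (suc n))
bin⁻-absorb n (suc k) = bin-absorb n k

bin-monoˡ : ∀ n k → bin n k ≤ bin (suc n) k
bin-monoˡ n k = ≤-trans (m≤n+m _ _) (≤-reflexive (sym (bin-suc n k)))

-- Counting sets of a given size.

#-size : ∀ n k → # {n} (λ A → ∣ A ∣ ≡ᵇ k) ≡ bin n k
#-size zero    zero    = refl
#-size zero    (suc k) = refl
#-size (suc n) zero    = cong₂ _+_ (∑-zero {n} λ _ → refl) (#-size n zero)
#-size (suc n) (suc k) = cong₂ _+_ (#-size n k) (#-size n (suc k))

-- A coordinate of `S` is forced and drops out of both sets. A coordinate outside `S` may be taken
-- or not, and the two cases are the two terms of Pascal's rule.
#-supersets : (P : Family n) (S : Subset n) (k : ℕ) →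
  (∀ A → A ∈F P → ∣ A ∣ ≡ k + ∣ S ∣ × S ⊆ A) → # P ≤ bin ∣ ∁ S ∣ k
#-supersets P [] zero    h = 𝟙-mono {P []} {true} (λ _ → refl)
#-supersets P [] (suc k) h = ≤-reflexive (#-∅ none)
  where
  none : ∀ A → ¬ A ∈F P
  none [] p = contradiction (proj₁ (h [] p)) λ ()
#-supersets {suc n} P (true ∷ S) k h =
  ≤-trans (+-mono-≤ (#-supersets _ S k h₁) (≤-reflexive (#-∅ none))) (≤-reflexive (+-identityʳ _))
  where
  h₁ : ∀ A → P (true ∷ A) ≡ true → ∣ A ∣ ≡ k + ∣ S ∣ × S ⊆ A
  h₁ A p with h (true ∷ A) p
  ... | e , s = suc-injective (trans e (+-suc k _)) , drop-∷-⊆ s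
  none : ∀ A → ¬ P (false ∷ A) ≡ true
  none A p = contradiction (proj₂ (h (false ∷ A) p) here) λ ()
#-supersets P (false ∷ S) k h =
  ≤-trans (+-mono-≤ (with-head k h) (#-supersets _ S k h₂)) (≤-reflexive (sym (bin-suc ∣ ∁ S ∣ k)))
  where
  h₂ : ∀ A → P (false ∷ A) ≡ true → ∣ A ∣ ≡ k + ∣ S ∣ × S ⊆ A
  h₂ A p = proj₁ (h _ p) , drop-∷-⊆ (proj₂ (h _ p))
  -- For `k = 0` nothing may be added to `S`, so no member takes the free coordinate; this is the
  -- case in which `bin⁻` is 0.
  with-head : ∀ k → (∀ A → A ∈F P → ∣ A ∣ ≡ k + ∣ S ∣ × (false ∷ S) ⊆ A) →
    # (P ∘ (true ∷_)) ≤ bin⁻ ∣ ∁ S ∣ k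
  with-head zero    h = ≤-reflexive (#-∅ none)
    where
    none : ∀ A → ¬ P (true ∷ A) ≡ true
    none A p with h (true ∷ A) p
    ... | e , s = <-irrefl (sym e) (s≤s (p⊆q⇒∣p∣≤∣q∣ (drop-∷-⊆ s)))
  with-head (suc k) h = #-supersets (P ∘ (true ∷_)) S k h₁
    where
    h₁ : ∀ A → P (true ∷ A) ≡ true → ∣ A ∣ ≡ k + ∣ S ∣ × S ⊆ A
    h₁ A p with h (true ∷ A) p
    ... | e , s = suc-injective e , drop-∷-⊆ s

∣⁅x⁆∪S∣ : (x : Fin n) (S : Subset n) → lookup S x ≡ false → ∣ ⁅ x ⁆ ∪ S ∣ ≡ suc ∣ S ∣
∣⁅x⁆∪S∣ zero    (false ∷ S) _ = cong suc (∣⊥∪S∣ S)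
  where
  ∣⊥∪S∣ : ∀ {n} (S : Subset n) → ∣ replicate n false ∪ S ∣ ≡ ∣ S ∣
  ∣⊥∪S∣ []          = refl
  ∣⊥∪S∣ (true ∷ S)  = cong suc (∣⊥∪S∣ S)
  ∣⊥∪S∣ (false ∷ S) = ∣⊥∪S∣ S
∣⁅x⁆∪S∣ (suc x) (true ∷ S)  p = cong suc (∣⁅x⁆∪S∣ x S p)
∣⁅x⁆∪S∣ (suc x) (false ∷ S) p = ∣⁅x⁆∪S∣ x S p

∑ᴸ-pairs-cong : {P : A → Set} {g h : A × A → ℕ} →
  (∀ x y → P x → P y → g (x , y) ≡ h (x , y)) →
  ∀ {xs} → All P xs → ∑ᴸ g (pairs xs) ≡ ∑ᴸ h (pairs xs)
∑ᴸ-pairs-cong e [] = refl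
∑ᴸ-pairs-cong {g = g} {h} e {x ∷ xs} (px ∷ pxs)
  rewrite ∑ᴸ-++ g (map (x ,_) xs) (pairs xs) | ∑ᴸ-++ h (map (x ,_) xs) (pairs xs)
        | ∑ᴸ-map g (x ,_) xs | ∑ᴸ-map h (x ,_) xs
  = cong₂ _+_ (row pxs) (∑ᴸ-pairs-cong e pxs)
  where
  row : ∀ {ys} → All _ ys → ∑ᴸ (g ∘ (x ,_)) ys ≡ ∑ᴸ (h ∘ (x ,_)) ys
  row []         = refl
  row (py ∷ pys) = cong₂ _+_ (e _ _ px py) (row pys)

-- Allows the membership factors of `isTriangle` to be dropped on a list all of whose entries are
-- members.
∑ᴸ-triples-cong : {P : A → Set} {g h : A × A × A → ℕ} →
  (∀ x y z → P x → P y → P z → g (x , y , z) ≡ h (x , y , z)) →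
  ∀ {xs} → All P xs → ∑ᴸ g (triples xs) ≡ ∑ᴸ h (triples xs)
∑ᴸ-triples-cong e [] = refl
∑ᴸ-triples-cong {g = g} {h} e {x ∷ xs} (px ∷ pxs)
  rewrite ∑ᴸ-++ g (map (x ,_) (pairs xs)) (triples xs) | ∑ᴸ-++ h (map (x ,_) (pairs xs)) (triples xs)
        | ∑ᴸ-map g (x ,_) (pairs xs) | ∑ᴸ-map h (x ,_) (pairs xs)
  = cong₂ _+_ (∑ᴸ-pairs-cong (λ y z → e x y z px) pxs) (∑ᴸ-triples-cong e pxs)

x∈p⇒0<∣p∣ : {x : Fin n} {p : Subset n} → x ∈ p → 0 < ∣ p ∣
x∈p⇒0<∣p∣ here                    = s≤s z≤n
x∈p⇒0<∣p∣ {p = true ∷ p}  (there q) = s≤s z≤n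
x∈p⇒0<∣p∣ {p = false ∷ p} (there q) = x∈p⇒0<∣p∣ q

0<∣p∣⇒nonempty : (p : Subset n) → 0 < ∣ p ∣ → Nonempty p
0<∣p∣⇒nonempty {n} p h with nonempty? p
... | yes q = q
... | no ¬q rewrite Empty-unique ¬q = contradiction (subst (0 <_) (∣⊥∣≡0 n) h) λ ()

-- Ordered triangles.

isTriangle : Family n → Subset n → Subset n → Subset n → Bool
isTriangle F A B C = F A ∧ (F B ∧ (F C ∧ emptyTriple (A , B , C)))

-- Ordered triples over the whole power set, repetitions allowed: such sums factor into products and
-- can be reindexed by permutations.
ord : Family n → ℕ
ord F = ∑ λ A → ∑ λ B → ∑ λ C → 𝟙 (isTriangle F A B C)

isTriangle⁻ : (F : Family n) (A B C : Subset n) → isTriangle F A B C ≡ true →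
  A ∈F F × B ∈F F × C ∈F F × ∣ A ∩ B ∩ C ∣ ≡ 0
isTriangle⁻ F A B C t with ∧-true⁻ {F A} t
... | a , t₁ with ∧-true⁻ {F B} t₁
... | b , t₂ with ∧-true⁻ {F C} t₂
... | c , t₃ = a , b , c , ≡ᵇ⁻ t₃

isTriangle⁺ : (F : Family n) (A B C : Subset n) →
  A ∈F F → B ∈F F → C ∈F F → ∣ A ∩ B ∩ C ∣ ≡ 0 → isTriangle F A B C ≡ true
isTriangle⁺ F A B C a b c e = ∧-true⁺ a (∧-true⁺ b (∧-true⁺ c (≡ᵇ⁺ e)))

-- A triple with a repeated member has the intersection of two members as its common part. In an
-- intersecting family this is nonempty, so only triples of distinct members count, each in six
-- orders.
ord≡6*triangles : (F : Family n) → Intersecting F → ord F ≡ 6 * triangles F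
ord≡6*triangles {n} F int = begin
  ord F
    ≡⟨ sym (trans (over-members _ λ A ¬a → trans (∑ᴸ-cong (λ B → ∑ᴸ-zero (λ C → out₁ ¬a) ms) ms) (∑ᴸ-zero (λ _ → refl) ms))
         (∑-cong λ A → trans (over-members _ λ B ¬b → ∑ᴸ-zero (λ C → out₂ A ¬b) ms)
         (∑-cong λ B → over-members _ λ C ¬c → out₃ A B ¬c))) ⟩
  ∑ᴸ (λ A → ∑ᴸ (λ B → ∑ᴸ (f A B) ms) ms) ms
    ≡⟨ ∑ᴸ-cube f s₁₂ s₂₃ degenerate ms ⟩
  6 * ∑ᴸ (λ (A , B , C) → f A B C) (triples ms)
    ≡⟨ cong (6 *_) (∑ᴸ-triples-cong on-members (all-filter (λ A → T? (F A)) (allSubsets n))) ⟩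
  6 * ∑ᴸ (𝟙 ∘ emptyTriple) (triples ms)
    ≡⟨ cong (6 *_) (sym (length-filter emptyTriple (triples ms))) ⟩
  6 * triangles F ∎
  where
  open ≡-Reasoning
  ms : List (Subset n)
  ms = members F
  f : Subset n → Subset n → Subset n → ℕ
  f A B C = 𝟙 (isTriangle F A B C)
  over-members : (g : Subset n → ℕ) → (∀ A → F A ≡ false → g A ≡ 0) → ∑ᴸ g ms ≡ ∑ g
  over-members g h = trans (∑ᴸ-filter F g h (allSubsets n)) (∑ᴸ-allSubsets n g)
  out₁ : ∀ {A B C} → F A ≡ false → f A B C ≡ 0
  out₁ e rewrite e = refl
  s₁₂ : ∀ A B C → f A B C ≡ f B A C
  s₁₂ A B C = cong 𝟙 (trans (∧-swap (F A) (F B)) (cong (λ S → F B ∧ (F A ∧ (F C ∧ (∣ S ∣ ≡ᵇ 0))))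
    (trans (sym (∩-assoc A B C)) (trans (cong (_∩ C) (∩-comm A B)) (∩-assoc B A C)))))
  s₂₃ : ∀ A B C → f A B C ≡ f A C B
  s₂₃ A B C = cong (λ t → 𝟙 (F A ∧ t)) (trans (∧-swap (F B) (F C))
    (cong (λ S → F C ∧ (F B ∧ (∣ A ∩ S ∣ ≡ᵇ 0))) (∩-comm B C)))
  out₂ : ∀ A {B C} → F B ≡ false → f A B C ≡ 0
  out₂ A {B} {C} e = trans (s₁₂ A B C) (out₁ {B} {A} {C} e)
  out₃ : ∀ A B {C} → F C ≡ false → f A B C ≡ 0
  out₃ A B {C} e = trans (s₂₃ A B C) (out₂ A e)
  degenerate : ∀ A B → f A A B ≡ 0
  degenerate A B with isTriangle F A A B in eq
  ... | false = refl
  ... | true with isTriangle⁻ F A A B eq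
  ...   | a , _ , b , e with int A B a b
  ...     | x , x∈ = let xA , xB = x∈p∩q⁻ A B x∈ in
            contradiction e (>⇒≢ (x∈p⇒0<∣p∣ (x∈p∩q⁺ (xA , x∈p∩q⁺ (xA , xB)))))
  on-members : ∀ A B C → T (F A) → T (F B) → T (F C) → f A B C ≡ 𝟙 (emptyTriple (A , B , C))
  on-members A B C a b c
    rewrite Equivalence.to T-≡ a | Equivalence.to T-≡ b | Equivalence.to T-≡ c = refl

isTriangle-⊆ : {F G : Family n} → F ⊆F G → ∀ A B C →
  isTriangle F A B C ≡ true → isTriangle G A B C ≡ true
isTriangle-⊆ {F = F} {G} s A B C t with isTriangle⁻ F A B C t
... | a , b , c , e = isTriangle⁺ G A B C (s A a) (s B b) (s C c) e

ord-mono : (F G : Family n) →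
  (∀ A B C → isTriangle F A B C ≡ true → isTriangle G A B C ≡ true) → ord F ≤ ord G
ord-mono F G h = ∑-mono λ A → ∑-mono λ B → ∑-mono λ C → 𝟙-mono (h A B C)

ord-⊆ : {F G : Family n} → F ⊆F G → ord F ≤ ord G
ord-⊆ {F = F} {G} s = ord-mono F G (isTriangle-⊆ s)

-- A single triangle of `G` that loses a member in `F` makes one summand drop from 1 to 0.
ord-⊂ : {F G : Family n} → F ⊆F G → ∀ {A B C} →
  isTriangle G A B C ≡ true → F A ≡ false → ord F < ord G
ord-⊂ {F = F} {G} s {A} {B} {C} t ¬a =
  ∑-mono-< (λ A → ∑-mono λ B → ∑-mono λ C → le A B C) A
    (∑-mono-< (λ B → ∑-mono λ C → le A B C) B
      (∑-mono-< (le A B) C lt))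
  where
  le : ∀ A B C → 𝟙 (isTriangle F A B C) ≤ 𝟙 (isTriangle G A B C)
  le A B C = 𝟙-mono (isTriangle-⊆ s A B C)
  lt : 𝟙 (isTriangle F A B C) < 𝟙 (isTriangle G A B C)
  lt rewrite ¬a | t = s≤s z≤n

isTriangle-act : (p : Perm n) (F : Family n) → ∀ A B C →
  isTriangle (F ∘ act p) A B C ≡ isTriangle F (act p A) (act p B) (act p C)
isTriangle-act p F A B C = cong (λ s → F (act p A) ∧ (F (act p B) ∧ (F (act p C) ∧ (s ≡ᵇ 0))))
  (trans (sym (∣act∣ p _))
    (cong ∣_∣ (trans (act-∩ p A (B ∩ C)) (cong (act p A ∩_) (act-∩ p B C)))))

ord-act : (p : Perm n) (F : Family n) → ord (F ∘ act p) ≡ ord F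
ord-act p F = begin
  ord (F ∘ act p)
    ≡⟨ ∑-cong (λ A → ∑-cong λ B → ∑-cong λ C → cong 𝟙 (isTriangle-act p F A B C)) ⟩
  ∑ (λ A → ∑ λ B → ∑ λ C → f (act p A) (act p B) (act p C))
    ≡⟨ ∑-cong (λ A → ∑-cong λ B → ∑-act p (f (act p A) (act p B))) ⟩
  ∑ (λ A → ∑ λ B → ∑ (f (act p A) (act p B)))
    ≡⟨ ∑-cong (λ A → ∑-act p (λ B → ∑ (f (act p A) B))) ⟩
  ∑ (λ A → ∑ λ B → ∑ (f (act p A) B))
    ≡⟨ ∑-act p (λ A → ∑ λ B → ∑ (f A B)) ⟩
  ord F ∎
  where
  open ≡-Reasoning
  f : Subset _ → Subset _ → Subset _ → ℕ
  f A B C = 𝟙 (isTriangle F A B C)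

-- The families of the extremal configuration

-- Inclusion-exclusion within `X`, where the union part is at most all of `X`; checked coordinate by
-- coordinate.
∣∩∣-modular : (A B X : Subset n) → ∣ A ∩ X ∣ + ∣ B ∩ X ∣ ≤ ∣ X ∣ + ∣ A ∩ B ∩ X ∣
∣∩∣-modular [] [] [] = z≤n
∣∩∣-modular (true  ∷ A) (true  ∷ B) (true ∷ X)
  rewrite +-suc (∣ A ∩ X ∣) (∣ B ∩ X ∣) | +-suc (∣ X ∣) (∣ A ∩ B ∩ X ∣) = s≤s (s≤s (∣∩∣-modular A B X))
∣∩∣-modular (true  ∷ A) (false ∷ B) (true ∷ X) = s≤s (∣∩∣-modular A B X)
∣∩∣-modular (false ∷ A) (true  ∷ B) (true ∷ X)
  rewrite +-suc (∣ A ∩ X ∣) (∣ B ∩ X ∣) = s≤s (∣∩∣-modular A B X)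
∣∩∣-modular (false ∷ A) (false ∷ B) (true ∷ X) = m≤n⇒m≤1+n (∣∩∣-modular A B X)
∣∩∣-modular (true  ∷ A) (true  ∷ B) (false ∷ X) = ∣∩∣-modular A B X
∣∩∣-modular (true  ∷ A) (false ∷ B) (false ∷ X) = ∣∩∣-modular A B X
∣∩∣-modular (false ∷ A) (true  ∷ B) (false ∷ X) = ∣∩∣-modular A B X
∣∩∣-modular (false ∷ A) (false ∷ B) (false ∷ X) = ∣∩∣-modular A B X

FX⁻ : ∀ {X : Subset n} {k A} → A ∈F FX X k → ∣ A ∣ ≡ k × 2 ≤ ∣ A ∩ X ∣
FX⁻ {X = X} {k} {A} p with ∧-true⁻ {∣ A ∣ ≡ᵇ k} p
... | a , b = ≡ᵇ⁻ a , ≤ᵇ⁻ b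

FX⁺ : ∀ {X : Subset n} {k A} → ∣ A ∣ ≡ k → 2 ≤ ∣ A ∩ X ∣ → A ∈F FX X k
FX⁺ a b = ∧-true⁺ (≡ᵇ⁺ a) (≤ᵇ⁺ b)

F'X⁻ : ∀ {X : Subset n} {k A} → A ∈F F'X X k → ∣ A ∣ ≡ k × ∣ A ∩ X ∣ ≡ 2
F'X⁻ {X = X} {k} {A} p with ∧-true⁻ {∣ A ∣ ≡ᵇ k} p
... | a , b = ≡ᵇ⁻ a , ≡ᵇ⁻ b

F'X⁺ : ∀ {X : Subset n} {k A} → ∣ A ∣ ≡ k → ∣ A ∩ X ∣ ≡ 2 → A ∈F F'X X k
F'X⁺ a b = ∧-true⁺ (≡ᵇ⁺ a) (≡ᵇ⁺ b)

-- Two traces of size at least 2 on three points overlap: `2 + 2 ≤ 3 + ∣ A ∩ B ∩ X ∣`.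
FX-intersecting : (X : Subset n) (k : ℕ) → ∣ X ∣ ≡ 3 → Intersecting (FX X k)
FX-intersecting X k hX A B a b =
  let _ , a₂ = FX⁻ {X = X} {k} {A} a
      _ , b₂ = FX⁻ {X = X} {k} {B} b
      x , x∈ = 0<∣p∣⇒nonempty (A ∩ B ∩ X) (+-cancelˡ-≤ 3 _ _
        (≤-trans (+-mono-≤ a₂ b₂) (subst (λ s → ∣ A ∩ X ∣ + ∣ B ∩ X ∣ ≤ s + ∣ A ∩ B ∩ X ∣) hX (∣∩∣-modular A B X))))
      xA , xBX = x∈p∩q⁻ A (B ∩ X) x∈
  in x , x∈p∩q⁺ (xA , proj₁ (x∈p∩q⁻ B X xBX))

-- Three sets with empty intersection have total degree at most 2∣X∣ = 6 on X, so all three meet X in exactly two points.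
FX-triangle⇒F'X : (X : Subset n) (k : ℕ) → ∣ X ∣ ≡ 3 → ∀ A B C →
  isTriangle (FX X k) A B C ≡ true → isTriangle (F'X X k) A B C ≡ true
FX-triangle⇒F'X X k hX A B C t with isTriangle⁻ (FX X k) A B C t
... | a , b , c , e
  with FX⁻ {X = X} {k} {A} a | FX⁻ {X = X} {k} {B} b | FX⁻ {X = X} {k} {C} c
... | ka , a₂ | kb , b₂ | kc , c₂ =
  isTriangle⁺ (F'X X k) A B C
    (F'X⁺ {X = X} {k} {A} ka (≤-antisym (+-cancelʳ-≤ 4 _ 2 (≤-trans (+-monoʳ-≤ ∣ A ∩ X ∣ (+-mono-≤ b₂ c₂)) total)) a₂))
    (F'X⁺ {X = X} {k} {B} kb (≤-antisym (+-cancelʳ-≤ 2 _ 2 (+-cancelˡ-≤ 2 _ _ (≤-trans (+-mono-≤ a₂ (+-monoʳ-≤ ∣ B ∩ X ∣ c₂)) total))) b₂))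
    (F'X⁺ {X = X} {k} {C} kc (≤-antisym (+-cancelˡ-≤ 4 _ _ (≤-trans (+-mono-≤ a₂ (+-monoˡ-≤ ∣ C ∩ X ∣ b₂)) total)) c₂))
    e
  where
  open ≤-Reasoning
  total : ∣ A ∩ X ∣ + (∣ B ∩ X ∣ + ∣ C ∩ X ∣) ≤ 6
  total = begin
    ∣ A ∩ X ∣ + (∣ B ∩ X ∣ + ∣ C ∩ X ∣)
      ≤⟨ +-monoʳ-≤ ∣ A ∩ X ∣ (∣∩∣-modular B C X) ⟩
    ∣ A ∩ X ∣ + (∣ X ∣ + ∣ B ∩ C ∩ X ∣)
      ≡⟨ rearrange (∣ A ∩ X ∣) (∣ X ∣) (∣ B ∩ C ∩ X ∣) ⟩
    ∣ X ∣ + (∣ A ∩ X ∣ + ∣ B ∩ C ∩ X ∣)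
      ≡⟨ cong (λ S → ∣ X ∣ + (∣ A ∩ X ∣ + ∣ S ∣)) (sym (∩-assoc B C X)) ⟩
    ∣ X ∣ + (∣ A ∩ X ∣ + ∣ (B ∩ C) ∩ X ∣)
      ≤⟨ +-monoʳ-≤ ∣ X ∣ (∣∩∣-modular A (B ∩ C) X) ⟩
    ∣ X ∣ + (∣ X ∣ + ∣ A ∩ (B ∩ C) ∩ X ∣)
      ≤⟨ +-monoʳ-≤ ∣ X ∣ (+-monoʳ-≤ ∣ X ∣ (≤-trans (p⊆q⇒∣p∣≤∣q∣ drop-X) (≤-reflexive e))) ⟩
    ∣ X ∣ + (∣ X ∣ + 0)
      ≡⟨ cong (λ s → s + (s + 0)) hX ⟩
    6 ∎
    where
    rearrange : ∀ a b c → a + (b + c) ≡ b + (a + c)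
    rearrange = solve-∀
    drop-X : A ∩ (B ∩ C) ∩ X ⊆ A ∩ B ∩ C
    drop-X x∈ = let xA , r = x∈p∩q⁻ A ((B ∩ C) ∩ X) x∈ in
      x∈p∩q⁺ (xA , proj₁ (x∈p∩q⁻ (B ∩ C) X r))

FX-act : (p : Perm n) (X : Subset n) (k : ℕ) → ∀ A → FX (act p X) k (act p A) ≡ FX X k A
FX-act p X k A = cong₂ (λ s t → (s ≡ᵇ k) ∧ (2 ≤ᵇ t)) (∣act∣ p A)
  (trans (cong ∣_∣ (sym (act-∩ p A X))) (∣act∣ p (A ∩ X)))

-- With `sort`, this makes the count independent of the choice of the 3-set. The two families agree
-- pointwise, which enters as two inclusions.
ord-FX : (p : Perm n) (X : Subset n) (k : ℕ) → ord (FX X k) ≡ ord (FX (act p X) k)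
ord-FX p X k = trans (≤-antisym (ord-⊆ {F = FX X k} {FX (act p X) k ∘ act p} λ A a → trans (FX-act p X k A) a)
                        (ord-⊆ {F = FX (act p X) k ∘ act p} {FX X k} λ A a → trans (sym (FX-act p X k A)) a))
                     (ord-act p (FX (act p X) k))

-- Sets of two and three points.

at : Fin n → Family n
at x A = lookup A x

lookup-false⇒≢ : {A : Subset n} {x y : Fin n} → lookup A x ≡ false → lookup A y ≡ true → x ≢ y
lookup-false⇒≢ p q refl = contradiction (trans (sym p) q) λ ()

lookup-false : {A : Subset n} {x : Fin n} → x ∉ A → lookup A x ≡ false
lookup-false {A = A} {x} x∉ with lookup A x in eq
... | false = refl
... | true  = contradiction (lookup⇒[]= x A eq) x∉

pair : Fin n → Fin n → Subset n
pair x y = ⁅ x ⁆ ∪ ⁅ y ⁆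

triple : Fin n → Fin n → Fin n → Subset n
triple x y z = ⁅ x ⁆ ∪ pair y z

∣pair∣ : {x y : Fin n} → x ≢ y → ∣ pair x y ∣ ≡ 2
∣pair∣ {x = x} {y} x≢y = trans
  (∣⁅x⁆∪S∣ x ⁅ y ⁆ (lookup-false (x≢y ∘ x∈⁅y⁆⇒x≡y y))) (cong suc (∣⁅x⁆∣≡1 y))

∣triple∣ : {x y z : Fin n} → x ≢ y → x ≢ z → y ≢ z → ∣ triple x y z ∣ ≡ 3
∣triple∣ {x = x} {y} {z} x≢y x≢z y≢z =
  trans (∣⁅x⁆∪S∣ x (pair y z) (lookup-false x∉)) (cong suc (∣pair∣ y≢z))
  where
  x∉ : x ∉ pair y z
  x∉ q with x∈p∪q⁻ ⁅ y ⁆ ⁅ z ⁆ q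
  ... | inj₁ r = x≢y (x∈⁅y⁆⇒x≡y y r)
  ... | inj₂ r = x≢z (x∈⁅y⁆⇒x≡y z r)

⁅x⁆∪S⊆A : {x : Fin n} {S A : Subset n} → lookup A x ≡ true → S ⊆ A → ⁅ x ⁆ ∪ S ⊆ A
⁅x⁆∪S⊆A {x = x} {S} {A} xA S⊆A q with x∈p∪q⁻ ⁅ x ⁆ S q
... | inj₁ r rewrite x∈⁅y⁆⇒x≡y x r = lookup⇒[]= x A xA
... | inj₂ r = S⊆A r

⁅x⁆⊆A : {x : Fin n} {A : Subset n} → lookup A x ≡ true → ⁅ x ⁆ ⊆ A
⁅x⁆⊆A {x = x} {A} xA r rewrite x∈⁅y⁆⇒x≡y x r = lookup⇒[]= x A xA

pair⊆A : {x y : Fin n} {A : Subset n} → lookup A x ≡ true → lookup A y ≡ true → pair x y ⊆ A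
pair⊆A {A = A} xA yA = ⁅x⁆∪S⊆A {A = A} xA (⁅x⁆⊆A {A = A} yA)

-- Heavy pairs

module Bounds {n k j m : ℕ} (k≡ : k ≡ 2 + j) (n≡ : n ≡ 3 + m)
  (F : Family n) (uniform : IsKUniform k F) (intersecting : Intersecting F) where

  -- C(n-2,k-2) and C(n-3,k-3): the numbers of k-sets through two and through three given points.
  c₂ c₃ : ℕ
  c₂ = bin (suc m) j
  c₃ = bin⁻ m j

  #-containing-pair : (P : Family n) {x y : Fin n} → P ⊆F F → x ≢ y →
    P ⊆F at x → P ⊆F at y → # P ≤ c₂
  #-containing-pair P {x} {y} P⊆F x≢y Px Py = subst (λ s → # P ≤ bin s j)
    (trans (∣∁p∣≡n∸∣p∣ (pair x y)) (cong₂ _∸_ n≡ (∣pair∣ x≢y)))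
    (#-supersets P (pair x y) j λ A p →
      trans (uniform A (P⊆F A p)) (trans k≡ (trans (+-comm 2 j) (cong (j +_) (sym (∣pair∣ x≢y))))) ,
      pair⊆A (Px A p) (Py A p))

  #-containing-triple : (P : Family n) {x y z : Fin n} → P ⊆F F → x ≢ y → x ≢ z → y ≢ z →
    P ⊆F at x → P ⊆F at y → P ⊆F at z → # P ≤ c₃
  #-containing-triple P {x} {y} {z} P⊆F x≢y x≢z y≢z Px Py Pz = by-size j k≡
    where
    S : Subset n
    S = triple x y z
    ∣S∣ : ∣ S ∣ ≡ 3
    ∣S∣ = ∣triple∣ x≢y x≢z y≢z
    S⊆ : ∀ A → A ∈F P → S ⊆ A
    S⊆ A p = ⁅x⁆∪S⊆A (Px A p) (pair⊆A (Py A p) (Pz A p))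
    -- For `k = 2` no member can hold three points, in agreement with `bin⁻ m 0 = 0`.
    by-size : ∀ j → k ≡ 2 + j → # P ≤ bin⁻ m j
    by-size zero e = ≤-reflexive (#-∅ λ A p → <-irrefl refl (begin
      3      ≡⟨ sym ∣S∣ ⟩
      ∣ S ∣  ≤⟨ p⊆q⇒∣p∣≤∣q∣ (S⊆ A p) ⟩
      ∣ A ∣  ≡⟨ trans (uniform A (P⊆F A p)) e ⟩
      2      ∎))
      where open ≤-Reasoning
    by-size (suc i) e = subst (λ s → # P ≤ bin s i)
      (trans (∣∁p∣≡n∸∣p∣ S) (cong₂ _∸_ n≡ ∣S∣))
      (#-supersets P S i λ A p →
        trans (uniform A (P⊆F A p)) (trans e (trans (+-comm 3 i) (cong (i +_) (sym ∣S∣)))) , S⊆ A p)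

  ∩F-⊆ˡ : (P Q : Family n) → (P ∩F Q) ⊆F P
  ∩F-⊆ˡ P Q A = proj₁ ∘ ∧-true⁻

  ∩F-⊆ʳ : (P Q : Family n) → (P ∩F Q) ⊆F Q
  ∩F-⊆ʳ P Q A = proj₂ ∘ ∧-true⁻ {P A}

  ∖F-⊆ : (P Q : Family n) → (P ∖F Q) ⊆F P
  ∖F-⊆ P Q A = proj₁ ∘ ∧-true⁻

  ∖F-∌ : (P : Family n) {x : Fin n} (A : Subset n) → A ∈F (P ∖F at x) → lookup A x ≡ false
  ∖F-∌ P {x} A p with lookup A x | proj₂ (∧-true⁻ {P A} p)
  ... | false | _ = refl

  -- Since `F` is intersecting, each member of `P` contains one of the `k` points of `G`, and the
  -- union bound runs over these points.
  #-branch : (P : Family n) {c : ℕ} {G : Subset n} → P ⊆F F → G ∈F F →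
    (∀ x → lookup G x ≡ true → # (P ∩F at x) ≤ c) → # P ≤ k * c
  #-branch P {c} {G} P⊆F g bound =
    subst (λ s → # P ≤ s * c) (uniform G g) (#-union-bound P G at bound meet)
    where
    meet : ∀ A → A ∈F P → ∃ λ x → lookup G x ≡ true × lookup A x ≡ true
    meet A p with intersecting A G (P⊆F A p) g
    ... | x , q = let xA , xG = x∈p∩q⁻ A G q in x , []=⇒lookup xG , []=⇒lookup xA

  through : Fin n → Fin n → Family n
  through x y = F ∩F at x ∩F at y

  through⁻ : ∀ x y A → A ∈F through x y → A ∈F F × lookup A x ≡ true × lookup A y ≡ true
  through⁻ x y A p with ∧-true⁻ {F A ∧ lookup A x} p
  ... | q , yA with ∧-true⁻ {F A} q
  ...   | a , xA = a , xA , yA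

  through-⊆ : ∀ x y → through x y ⊆F F
  through-⊆ x y A = proj₁ ∘ through⁻ x y A

  deg₂ : Fin n → Fin n → ℕ
  deg₂ x y = # (through x y)

  #≤deg₂ : (P : Family n) {x y : Fin n} → P ⊆F F → P ⊆F at x → P ⊆F at y → # P ≤ deg₂ x y
  #≤deg₂ P P⊆F Px Py = #-mono λ A p → ∧-true⁺ (∧-true⁺ (P⊆F A p) (Px A p)) (Py A p)

  deg₃≤c₃ : ∀ {x y z} → x ≢ y → x ≢ z → y ≢ z → # (through x y ∩F at z) ≤ c₃
  deg₃≤c₃ {x} {y} {z} x≢y x≢z y≢z =
    #-containing-triple P (λ A → proj₁ ∘ split A) x≢y x≢z y≢z
      (λ A → proj₁ ∘ proj₂ ∘ split A) (λ A → proj₂ ∘ proj₂ ∘ split A) (∩F-⊆ʳ (through x y) (at z))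
    where
    P : Family n
    P = through x y ∩F at z
    split : ∀ A → A ∈F P → A ∈F F × lookup A x ≡ true × lookup A y ≡ true
    split A = through⁻ x y A ∘ ∩F-⊆ˡ (through x y) (at z) A

  Heavy : Fin n → Fin n → Set
  Heavy x y = x ≢ y × k * c₃ < deg₂ x y

  Heavy? : ∀ x y → Dec (Heavy x y)
  Heavy? x y = ¬? (x ≟ y) ×-dec (suc (k * c₃) ≤? deg₂ x y)

  ¬Heavy⇒light : ∀ {x y} → x ≢ y → ¬ Heavy x y → deg₂ x y ≤ k * c₃
  ¬Heavy⇒light x≢y h = ≮⇒≥ λ lt → h (x≢y , lt)

  Heavy-sym : ∀ {x y} → Heavy x y → Heavy y x
  Heavy-sym {x} {y} (x≢y , lt) = (λ e → x≢y (sym e)) ,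
    ≤-trans lt (#≤deg₂ (through x y) (through-⊆ x y)
      (λ A → proj₂ ∘ proj₂ ∘ through⁻ x y A) (λ A → proj₁ ∘ proj₂ ∘ through⁻ x y A))

  -- Branching over a member that misses both points would put a third point into each member
  -- through them, which leaves at most `k * c₃` of these.
  Heavy-covers : ∀ {x y} → Heavy x y → ∀ A → A ∈F F → lookup A x ≡ true ⊎ lookup A y ≡ true
  Heavy-covers {x} {y} (x≢y , lt) A a with lookup A x in ex | lookup A y in ey
  ... | true  | _     = inj₁ refl
  ... | false | true  = inj₂ refl
  ... | false | false = contradiction
    (#-branch (through x y) (through-⊆ x y) a λ z zA →
      deg₃≤c₃ x≢y (lookup-false⇒≢ {A = A} ex zA) (lookup-false⇒≢ {A = A} ey zA))
    (<⇒≱ lt)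

  -- All members through a heavy pair meet every other heavy pair; two disjoint ones would give deg₂ ≤ 2 c₃ ≤ k c₃.
  Heavy-meet : ∀ {x y u v} → Heavy x y → Heavy u v → ¬ (x ≢ u × y ≢ u × x ≢ v × y ≢ v)
  Heavy-meet {x} {y} {u} {v} (x≢y , lt) huv (x≢u , y≢u , x≢v , y≢v) = <⇒≱ lt (begin
    deg₂ x y  ≤⟨ #-union-bound (through x y) (true ∷ true ∷ []) Q bound cover ⟩
    2 * c₃    ≤⟨ *-monoˡ-≤ c₃ (subst (2 ≤_) (sym k≡) (m≤m+n 2 j)) ⟩
    k * c₃    ∎)
    where
    open ≤-Reasoning
    Q : Fin 2 → Family n
    Q zero       = at u
    Q (suc zero) = at v
    bound : ∀ i → lookup (true ∷ true ∷ []) i ≡ true → # (through x y ∩F Q i) ≤ c₃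
    bound zero       _ = deg₃≤c₃ x≢y x≢u y≢u
    bound (suc zero) _ = deg₃≤c₃ x≢y x≢v y≢v
    cover : ∀ A → A ∈F through x y → ∃ λ i → lookup (true ∷ true ∷ []) i ≡ true × A ∈F Q i
    cover A p with Heavy-covers huv A (through-⊆ x y A p)
    ... | inj₁ q = zero , refl , q
    ... | inj₂ q = suc zero , refl , q

  ∀∋⇒ord≡0 : (x : Fin n) → F ⊆F at x → ord F ≡ 0
  ∀∋⇒ord≡0 x all = ∑-zero λ A → ∑-zero λ B → ∑-zero λ C → none A B C
    where
    none : ∀ A B C → 𝟙 (isTriangle F A B C) ≡ 0
    none A B C with isTriangle F A B C in eq
    ... | false = refl
    ... | true with isTriangle⁻ F A B C eq
    ...   | a , b , c , e = contradiction e (>⇒≢ (x∈p⇒0<∣p∣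
              (x∈p∩q⁺ (mem A a , x∈p∩q⁺ (mem B b , mem C c)))))
      where
      mem : ∀ A → A ∈F F → x ∈ A
      mem A a = lookup⇒[]= x A (all A a)

  -- Three members through `x` are no triangle, so some member misses `x`. The factor 3 is for its
  -- position; the other two members are arbitrary.
  ord-bound : (x : Fin n) → ord F ≤ 3 * (# (F ∖F at x) * (# F * # F))
  ord-bound x = begin
    ord F
      ≤⟨ ∑-mono (λ A → ∑-mono λ B → ∑-mono λ C → pointwise A B C) ⟩
    ∑ (λ A → ∑ λ B → ∑ λ C → a A * (f B * f C) + (f A * (a B * f C) + f A * (f B * a C)))
      ≡⟨ ∑³-+ (λ A B C → a A * (f B * f C)) (λ A B C → f A * (a B * f C) + f A * (f B * a C)) ⟩
    ∑ (λ A → ∑ λ B → ∑ λ C → a A * (f B * f C)) +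
      ∑ (λ A → ∑ λ B → ∑ λ C → f A * (a B * f C) + f A * (f B * a C))
      ≡⟨ cong (∑ (λ A → ∑ λ B → ∑ λ C → a A * (f B * f C)) +_)
           (∑³-+ (λ A B C → f A * (a B * f C)) (λ A B C → f A * (f B * a C))) ⟩
    ∑ (λ A → ∑ λ B → ∑ λ C → a A * (f B * f C)) +
      (∑ (λ A → ∑ λ B → ∑ λ C → f A * (a B * f C)) + ∑ (λ A → ∑ λ B → ∑ λ C → f A * (f B * a C)))
      ≡⟨ cong₂ _+_ (∑³-* a f f) (cong₂ _+_ (∑³-* f a f) (∑³-* f f a)) ⟩
    ∑ a * (∑ f * ∑ f) + (∑ f * (∑ a * ∑ f) + ∑ f * (∑ f * ∑ a))
      ≡⟨ collect (∑ a) (∑ f) ⟩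
    3 * (∑ a * (∑ f * ∑ f)) ∎
    where
    open ≤-Reasoning
    a f : Subset n → ℕ
    a A = 𝟙 ((F ∖F at x) A)
    f A = 𝟙 (F A)
    ∑³-+ : (g h : Subset n → Subset n → Subset n → ℕ) →
      ∑ (λ A → ∑ λ B → ∑ λ C → g A B C + h A B C) ≡
      ∑ (λ A → ∑ λ B → ∑ λ C → g A B C) + ∑ (λ A → ∑ λ B → ∑ λ C → h A B C)
    ∑³-+ g h = trans
      (∑-cong λ A → trans (∑-cong λ B → ∑-+ (g A B) (h A B)) (∑-+ (λ B → ∑ (g A B)) (λ B → ∑ (h A B))))
      (∑-+ (λ A → ∑ λ B → ∑ (g A B)) (λ A → ∑ λ B → ∑ (h A B)))
    collect : ∀ a f → a * (f * f) + (f * (a * f) + f * (f * a)) ≡ 3 * (a * (f * f))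
    collect = solve-∀
    pointwise : ∀ A B C → 𝟙 (isTriangle F A B C) ≤
      a A * (f B * f C) + (f A * (a B * f C) + f A * (f B * a C))
    pointwise A B C with isTriangle F A B C in eq
    ... | false = z≤n
    ... | true with isTriangle⁻ F A B C eq
    ...   | pA , pB , pC , e rewrite pA | pB | pC
      with lookup A x in xA | lookup B x in xB | lookup C x in xC
    ... | false | _     | _     = s≤s z≤n
    ... | true  | false | _     = s≤s z≤n
    ... | true  | true  | false = s≤s z≤n
    ... | true  | true  | true  = contradiction e (>⇒≢ (x∈p⇒0<∣p∣
            (x∈p∩q⁺ (lookup⇒[]= x A xA , x∈p∩q⁺ (lookup⇒[]= x B xB , lookup⇒[]= x C xC)))))

  -- The case in which no point lies in all members. The members that miss given points are the sets
  -- to branch over.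
  module Avoidable (avoid : ∀ x → ∃ λ A → A ∈F F × lookup A x ≡ false) where

    deg-bound : ∀ x → # (F ∩F at x) ≤ k * c₂
    deg-bound x with avoid x
    ... | G , g , xG = #-branch (F ∩F at x) (∩F-⊆ˡ F (at x)) g λ y yG →
      #-containing-pair (through x y) (through-⊆ x y) (lookup-false⇒≢ {A = G} xG yG)
        (λ A → proj₁ ∘ proj₂ ∘ through⁻ x y A) (λ A → proj₂ ∘ proj₂ ∘ through⁻ x y A)

    -- Members missing `x` contain `y`, as the heavy pair covers them. Branching over a member `G`
    -- that misses `y` adds a point `z`; here `z = x` is impossible, and for `z ≢ x` the pair of `y`
    -- and `z` avoids the centre `x`, hence is light.
    #-star : ∀ {x y} → Heavy x y → (∀ u v → Heavy u v → x ≡ u ⊎ x ≡ v) →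
      # (F ∖F at x) ≤ k * (k * c₃)
    #-star {x} {y} h star with avoid y
    ... | G , g , yG = #-branch P (∖F-⊆ F (at x)) g bound
      where
      P : Family n
      P = F ∖F at x
      Py : P ⊆F at y
      Py A p with Heavy-covers h A (∖F-⊆ F (at x) A p)
      ... | inj₁ xA = contradiction (trans (sym (∖F-∌ F {x} A p)) xA) λ ()
      ... | inj₂ yA = yA
      bound : ∀ z → lookup G z ≡ true → # (P ∩F at z) ≤ k * c₃
      bound z zG with x ≟ z
      ... | yes refl = ≤-trans (≤-reflexive (#-∅ none)) z≤n
        where
        none : ∀ A → ¬ A ∈F (P ∩F at x)
        none A p = contradiction
          (trans (sym (∖F-∌ F {x} A (∩F-⊆ˡ P (at x) A p))) (∩F-⊆ʳ P (at x) A p)) λ ()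
      ... | no x≢z = ≤-trans
        (#≤deg₂ (P ∩F at z) (λ A → ∖F-⊆ F (at x) A ∘ ∩F-⊆ˡ P (at z) A)
          (λ A → Py A ∘ ∩F-⊆ˡ P (at z) A) (∩F-⊆ʳ P (at z)))
        (¬Heavy⇒light (lookup-false⇒≢ {A = G} yG zG) λ hyz → not-star (star y z hyz))
        where
        not-star : ¬ (x ≡ y ⊎ x ≡ z)
        not-star (inj₁ e) = proj₁ h e
        not-star (inj₂ e) = x≢z e

    -- Two branchings fix two distinct points of a member, and the pair they form is light.
    #-light : (∀ u v → ¬ Heavy u v) → Fin n → # F ≤ k * (k * (k * c₃))
    #-light light x with avoid x
    ... | G , g , _ = #-branch F (λ _ p → p) g λ y yG → bound y
      where
      bound : ∀ y → # (F ∩F at y) ≤ k * (k * c₃)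
      bound y with avoid y
      ... | H , h , yH = #-branch (F ∩F at y) (∩F-⊆ˡ F (at y)) h λ z zH →
        ¬Heavy⇒light (lookup-false⇒≢ {A = H} yH zH) (light y z)

    heavy-triangle : ∀ {x y z} → Heavy x y → Heavy x z → Heavy y z → F ⊆F FX (triple x y z) k
    heavy-triangle {x} {y} {z} hxy hxz hyz A a = FX⁺ {X = triple x y z} {k} {A} (uniform A a) two
      where
      X : Subset n
      X = triple x y z
      via : ∀ {u v} → u ≢ v → u ∈ X → v ∈ X → lookup A u ≡ true → lookup A v ≡ true → 2 ≤ ∣ A ∩ X ∣
      via {u} {v} u≢v uX vX uA vA = subst (_≤ ∣ A ∩ X ∣) (∣pair∣ u≢v)
        (p⊆q⇒∣p∣≤∣q∣ {p = pair u v} {A ∩ X} λ q → x∈p∩q⁺ (pair⊆A uA vA q ,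
          pair⊆A ([]=⇒lookup uX) ([]=⇒lookup vX) q))
      x∈X : x ∈ X
      x∈X = x∈p∪q⁺ (inj₁ (x∈⁅x⁆ x))
      y∈X : y ∈ X
      y∈X = x∈p∪q⁺ {p = ⁅ x ⁆} (inj₂ (x∈p∪q⁺ (inj₁ (x∈⁅x⁆ y))))
      z∈X : z ∈ X
      z∈X = x∈p∪q⁺ {p = ⁅ x ⁆} (inj₂ (x∈p∪q⁺ {p = ⁅ y ⁆} (inj₂ (x∈⁅x⁆ z))))
      two : 2 ≤ ∣ A ∩ X ∣
      two with Heavy-covers hxy A a | Heavy-covers hxz A a | Heavy-covers hyz A a
      ... | inj₁ p | inj₂ q | _      = via (proj₁ hxz) x∈X z∈X p q
      ... | inj₁ p | inj₁ _ | inj₁ q = via (proj₁ hxy) x∈X y∈X p q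
      ... | inj₁ p | inj₁ _ | inj₂ q = via (proj₁ hxz) x∈X z∈X p q
      ... | inj₂ p | inj₁ q | _      = via (proj₁ hxy) x∈X y∈X q p
      ... | inj₂ p | inj₂ q | _      = via (proj₁ hyz) y∈X z∈X p q

    k³ : ∀ k c → k * (k * (k * c)) ≡ k * (k * (k * 1)) * c
    k³ = solve-∀

    -- Weakens the star bound to that of the light case, so that both share one estimate.
    k²≤k³ : k * (k * c₃) ≤ k ^ 3 * c₃
    k²≤k³ = ≤-trans (m≤n*m (k * (k * c₃)) k) (≤-reflexive (k³ k c₃))
      where
      instance
        k≢0 : NonZero k
        k≢0 = subst NonZero (sym k≡) _

    -- Pairwise meeting pairs form a star or a triangle. The given point `o` serves as `x` when no
    -- pair is heavy; any point would do then.
    structure : Fin n →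
      (∃ λ x → # (F ∖F at x) ≤ k ^ 3 * c₃) ⊎ (∃ λ X → ∣ X ∣ ≡ 3 × F ⊆F FX X k)
    structure o with any? (λ x → any? (Heavy? x))
    ... | no ¬h = inj₁ (o , (begin
      # (F ∖F at o)       ≤⟨ #-mono (∖F-⊆ F (at o)) ⟩
      # F                 ≤⟨ #-light (λ u v h → ¬h (u , v , h)) o ⟩
      k * (k * (k * c₃))  ≡⟨ k³ k c₃ ⟩
      k ^ 3 * c₃          ∎))
      where open ≤-Reasoning
    ... | yes (x , y , h) with avoiding? x | avoiding? y
      where
      avoiding? : ∀ w → Dec (∃ λ u → ∃ λ v → w ≢ u × w ≢ v × Heavy u v)
      avoiding? w = any? λ u → any? λ v → ¬? (w ≟ u) ×-dec (¬? (w ≟ v) ×-dec Heavy? u v)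
    ... | no ¬a | _ = inj₁ (x , ≤-trans (#-star h star) k²≤k³)
      where
      star : ∀ u v → Heavy u v → x ≡ u ⊎ x ≡ v
      star u v huv with x ≟ u | x ≟ v
      ... | yes e | _     = inj₁ e
      ... | no _  | yes e = inj₂ e
      ... | no p  | no q  = contradiction (u , v , p , q , huv) ¬a
    ... | yes _ | no ¬a = inj₁ (y , ≤-trans (#-star (Heavy-sym h) star) k²≤k³)
      where
      star : ∀ u v → Heavy u v → y ≡ u ⊎ y ≡ v
      star u v huv with y ≟ u | y ≟ v
      ... | yes e | _     = inj₁ e
      ... | no _  | yes e = inj₂ e
      ... | no p  | no q  = contradiction (u , v , p , q , huv) ¬a
    -- Neither end is a centre. A heavy pair avoiding `x` must meet the first pair in `y`, which
    -- gives a heavy pair of `y` and `z`; likewise one of `x` and `w`. These two must meet in turn,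
    -- which forces `z = w`.
    ... | yes (u , v , x≢u , x≢v , huv) | yes (s , t , y≢s , y≢t , hst)
      with other-end x≢u x≢v h huv | other-end y≢s y≢t (Heavy-sym h) hst
      where
      other-end : ∀ {x y u v} → x ≢ u → x ≢ v → Heavy x y → Heavy u v →
        ∃ λ z → x ≢ z × Heavy y z
      other-end {x} {y} {u} {v} x≢u x≢v h huv with y ≟ u | y ≟ v
      ... | yes refl | _        = v , x≢v , huv
      ... | no _     | yes refl = u , x≢u , Heavy-sym huv
      ... | no y≢u   | no y≢v   = contradiction (x≢u , y≢u , x≢v , y≢v) (Heavy-meet h huv)
    ... | z , x≢z , hyz | w , y≢w , hxw with z ≟ w
    ...   | yes refl = inj₂ (triple x y z , ∣triple∣ (proj₁ h) x≢z (proj₁ hyz) , heavy-triangle h hxw hyz)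
    ...   | no z≢w   = contradiction
      ((λ e → proj₁ h (sym e)) , (λ e → x≢z (sym e)) , y≢w , z≢w) (Heavy-meet hyz hxw)

-- Numerical estimates

module Numerics (k j m : ℕ) (k≡ : k ≡ 2 + j) (large : 4 * k ^ 6 ≤ 3 + m) where
  open ≤-Reasoning

  instance
    k≢0 : NonZero k
    k≢0 = subst NonZero (sym k≡) _
    k⁵≢0 : NonZero (k ^ 5)
    k⁵≢0 = m^n≢0 k 5

  -- For `n = 3 + m` these are C(n-2,k-2), C(n-3,k-3) and C(n-3,k-2).
  c e M : ℕ
  c = bin (suc m) j
  e = bin⁻ m j
  M = bin m j

  -- Leaves room outside the 3-set for two disjoint sets of size `j`.
  2j≤m : j + j ≤ m
  2j≤m = +-cancelˡ-≤ 3 _ _ (begin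
    3 + (j + j)          ≤⟨ m≤m+n _ (5 + (j + j)) ⟩
    3 + (j + j) + (5 + (j + j)) ≡⟨ arith j ⟩
    4 * (2 + j)          ≡⟨ cong (4 *_) (sym k≡) ⟩
    4 * k                ≤⟨ *-monoʳ-≤ 4 (m≤m*n k (k ^ 5)) ⟩
    4 * k ^ 6            ≤⟨ large ⟩
    3 + m                ∎)
    where
    arith : ∀ j → 3 + (j + j) + (5 + (j + j)) ≡ 4 * (2 + j)
    arith = solve-∀

  c>0 : 0 < c
  c>0 = bin>0 (suc m) j (≤-trans (m≤m+n j j) (m≤n⇒m≤1+n 2j≤m))

  2≤k : 2 ≤ k
  2≤k = subst (2 ≤_) (sym k≡) (m≤m+n 2 j)

  c≡ : c ≡ e + M
  c≡ = bin-suc m j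

  e≤c : e ≤ c
  e≤c = ≤-trans (m≤m+n e M) (≤-reflexive (sym c≡))

  -- Absorption gives `j * c = suc m * e`, whence `(3 + m) * e ≤ (2 + j) * c = k * c`. The size
  -- assumption bounds the left side from below, and one factor `k` cancels.
  k⁵e : 4 * (k ^ 5 * e) ≤ c
  k⁵e = *-cancelˡ-≤ k (begin
    k * (4 * (k ^ 5 * e))  ≡⟨ arith₁ k (k ^ 5) e ⟩
    4 * k ^ 6 * e          ≤⟨ *-monoˡ-≤ e large ⟩
    (3 + m) * e            ≡⟨ arith₂ m e ⟩
    suc m * e + 2 * e      ≡⟨ cong (_+ 2 * e) (sym (bin⁻-absorb m j)) ⟩
    j * c + 2 * e          ≤⟨ +-monoʳ-≤ (j * c) (*-monoʳ-≤ 2 e≤c) ⟩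
    j * c + 2 * c          ≡⟨ arith₃ j c ⟩
    (2 + j) * c            ≡⟨ cong (_* c) (sym k≡) ⟩
    k * c                  ∎)
    where
    arith₁ : ∀ k p e → k * (4 * (p * e)) ≡ 4 * (k * p) * e
    arith₁ = solve-∀
    arith₂ : ∀ m e → (3 + m) * e ≡ suc m * e + 2 * e
    arith₂ = solve-∀
    arith₃ : ∀ j c → j * c + 2 * c ≡ (2 + j) * c
    arith₃ = solve-∀

  -- `t` bounds the members missing a suitable point and `r` all members; `G` bounds from below the
  -- `j`-sets disjoint from a given one, and `d` bounds the shortfall of `M` and `G` from `c`. `U`
  -- and `L` are the resulting bounds on the ordered triangles of `F` and of the extremal family.
  t d r G U L : ℕ
  t = k ^ 3 * e
  d = k * e
  r = k * c + t
  G = M ∸ j * e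
  U = 3 * (t * (r * r))
  L = M * (G * M)

  4k²t≤c : 4 * (k * (k * t)) ≤ c
  4k²t≤c = ≤-trans (≤-reflexive (arith k e)) k⁵e
    where
    arith : ∀ k e → 4 * (k * (k * (k * (k * (k * 1)) * e))) ≡ 4 * (k * (k * (k * (k * (k * 1)))) * e)
    arith = solve-∀

  8kt≤c : 8 * (k * t) ≤ c
  8kt≤c = begin
    8 * (k * t)        ≡⟨ arith (k * t) ⟩
    4 * (2 * (k * t))  ≤⟨ *-monoʳ-≤ 4 (*-monoˡ-≤ (k * t) 2≤k) ⟩
    4 * (k * (k * t))  ≤⟨ 4k²t≤c ⟩
    c                  ∎
    where
    arith : ∀ x → 8 * x ≡ 4 * (2 * x)
    arith = solve-∀

  16t≤c : 16 * t ≤ c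
  16t≤c = begin
    16 * t        ≡⟨ arith t ⟩
    8 * (2 * t)   ≤⟨ *-monoʳ-≤ 8 (*-monoˡ-≤ t 2≤k) ⟩
    8 * (k * t)   ≤⟨ 8kt≤c ⟩
    c             ∎
    where
    arith : ∀ x → 16 * x ≡ 8 * (2 * x)
    arith = solve-∀

  24d≤c : 24 * d ≤ c
  24d≤c = begin
    24 * d            ≤⟨ m≤m+n _ (8 * d) ⟩
    24 * d + 8 * d    ≡⟨ arith₁ d ⟩
    8 * (2 * (2 * d)) ≤⟨ *-monoʳ-≤ 8 (*-mono-≤ 2≤k (*-monoˡ-≤ d 2≤k)) ⟩
    8 * (k * (k * d)) ≡⟨ arith₂ k e ⟩
    8 * t             ≤⟨ *-monoˡ-≤ t (m≤m+n 8 8) ⟩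
    16 * t            ≤⟨ 16t≤c ⟩
    c                 ∎
    where
    arith₁ : ∀ d → 24 * d + 8 * d ≡ 8 * (2 * (2 * d))
    arith₁ = solve-∀
    arith₂ : ∀ k e → 8 * (k * (k * (k * e))) ≡ 8 * (k * (k * (k * 1)) * e)
    arith₂ = solve-∀

  -- The main term `3 * t * (k * c)²` is at most 3/4 of `c³`, which is the 24 out of 32. The terms
  -- with `t²` and `t³` add at most 2 and 1.
  upper : 32 * U ≤ 27 * (c * (c * c))
  upper = begin
    32 * U
      ≡⟨ expand k c t ⟩
    24 * ((4 * (k * (k * t))) * (c * c)) + (2 * (96 * ((k * t) * (t * c))) + 96 * (t * (t * t)))
      ≤⟨ +-mono-≤ (*-monoʳ-≤ 24 (*-monoˡ-≤ (c * c) 4k²t≤c)) (+-mono-≤ (*-monoʳ-≤ 2 mid) low) ⟩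
    24 * (c * (c * c)) + (2 * (c * (c * c)) + c * (c * c))
      ≡⟨ collect (c * (c * c)) ⟩
    27 * (c * (c * c)) ∎
    where
    expand : ∀ k c t → 32 * (3 * (t * ((k * c + t) * (k * c + t)))) ≡
      24 * ((4 * (k * (k * t))) * (c * c)) + (2 * (96 * ((k * t) * (t * c))) + 96 * (t * (t * t)))
    expand = solve-∀
    collect : ∀ x → 24 * x + (2 * x + x) ≡ 27 * x
    collect = solve-∀
    mid : 96 * ((k * t) * (t * c)) ≤ c * (c * c)
    mid = begin
      96 * ((k * t) * (t * c))              ≤⟨ *-monoˡ-≤ ((k * t) * (t * c)) (m≤m+n 96 32) ⟩
      128 * ((k * t) * (t * c))             ≡⟨ arith (k * t) t c ⟩
      (8 * (k * t)) * ((16 * t) * c)        ≤⟨ *-mono-≤ 8kt≤c (*-monoˡ-≤ c 16t≤c) ⟩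
      c * (c * c)                           ∎
      where
      arith : ∀ x t c → 128 * (x * (t * c)) ≡ (8 * x) * ((16 * t) * c)
      arith = solve-∀
    low : 96 * (t * (t * t)) ≤ c * (c * c)
    low = begin
      96 * (t * (t * t))          ≤⟨ *-monoˡ-≤ (t * (t * t)) (m≤m+n 96 160) ⟩
      256 * (t * (t * t))         ≡⟨ arith t ⟩
      (16 * t) * ((16 * t) * t)   ≤⟨ *-mono-≤ 16t≤c (*-mono-≤ 16t≤c (≤-trans (m≤n*m t 16) 16t≤c)) ⟩
      c * (c * c)                 ∎
      where
      arith : ∀ t → 256 * (t * (t * t)) ≡ (16 * t) * ((16 * t) * t)
      arith = solve-∀

  -- Each factor of `L` is at least `c - d` with `24 * d ≤ c`, and (1 - 1/24)³ ≥ 1 - 3/24 = 28/32.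
  lower : 28 * (c * (c * c)) ≤ 32 * L
  lower = begin
    28 * X            ≡⟨ *-assoc 4 7 X ⟩
    4 * (7 * X)       ≤⟨ *-monoʳ-≤ 4 (+-cancelʳ-≤ X _ _ 8X≤) ⟩
    4 * (8 * L)       ≡⟨ sym (*-assoc 4 8 L) ⟩
    32 * L            ∎
    where
    X : ℕ
    X = c * (c * c)
    M≤c : M ≤ c
    M≤c = ≤-trans (m≤n+m M e) (≤-reflexive (sym c≡))
    e≤d : e ≤ d
    e≤d = m≤n*m e k
    c≤M : c ≤ M + d
    c≤M = begin
      c      ≡⟨ trans c≡ (+-comm e M) ⟩
      M + e  ≤⟨ +-monoʳ-≤ M e≤d ⟩
      M + d  ∎
    c≤G : c ≤ G + d
    c≤G = begin
      c                ≡⟨ c≡ ⟩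
      e + M            ≤⟨ +-monoʳ-≤ e (≤-trans (m≤n+m∸n M (j * e)) (≤-reflexive (+-comm (j * e) G))) ⟩
      e + (G + j * e)  ≤⟨ m≤n+m _ e ⟩
      e + (e + (G + j * e)) ≡⟨ arith e G j ⟩
      G + (2 + j) * e  ≡⟨ cong (λ x → G + x * e) (sym k≡) ⟩
      G + d            ∎
      where
      arith : ∀ e G j → e + (e + (G + j * e)) ≡ G + (2 + j) * e
      arith = solve-∀
    -- The factors `c` are replaced by `M`, `G` and `M` in turn, and each exchange costs at most
    -- `d * (c * c)`.
    bernoulli : X ≤ L + 3 * (d * (c * c))
    bernoulli = begin
      c * (c * c)
        ≤⟨ *-monoˡ-≤ (c * c) c≤M ⟩
      (M + d) * (c * c)
        ≡⟨ arith₁ M d c ⟩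
      M * (c * c) + d * (c * c)
        ≤⟨ +-monoˡ-≤ (d * (c * c)) (*-monoʳ-≤ M (*-monoˡ-≤ c c≤G)) ⟩
      M * ((G + d) * c) + d * (c * c)
        ≡⟨ arith₂ M G d c ⟩
      M * (G * c) + (M * (d * c) + d * (c * c))
        ≤⟨ +-mono-≤ (*-monoʳ-≤ M (*-monoʳ-≤ G c≤M)) (+-monoˡ-≤ (d * (c * c)) (*-monoˡ-≤ (d * c) M≤c)) ⟩
      M * (G * (M + d)) + (c * (d * c) + d * (c * c))
        ≡⟨ arith₃ M G d c ⟩
      L + (M * (G * d) + 2 * (d * (c * c)))
        ≤⟨ +-monoʳ-≤ L (+-monoˡ-≤ (2 * (d * (c * c))) (*-mono-≤ M≤c (*-monoˡ-≤ d (≤-trans (m∸n≤m M (j * e)) M≤c)))) ⟩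
      L + (c * (c * d) + 2 * (d * (c * c)))
        ≡⟨ arith₄ L c d ⟩
      L + 3 * (d * (c * c)) ∎
      where
      arith₁ : ∀ M d c → (M + d) * (c * c) ≡ M * (c * c) + d * (c * c)
      arith₁ = solve-∀
      arith₂ : ∀ M G d c → M * ((G + d) * c) + d * (c * c) ≡ M * (G * c) + (M * (d * c) + d * (c * c))
      arith₂ = solve-∀
      arith₃ : ∀ M G d c → M * (G * (M + d)) + (c * (d * c) + d * (c * c)) ≡
        M * (G * M) + (M * (G * d) + 2 * (d * (c * c)))
      arith₃ = solve-∀
      arith₄ : ∀ L c d → L + (c * (c * d) + 2 * (d * (c * c))) ≡ L + 3 * (d * (c * c))
      arith₄ = solve-∀
    8X≤ : 7 * X + X ≤ 8 * L + X
    8X≤ = begin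
      7 * X + X                    ≡⟨ +-comm (7 * X) X ⟩
      8 * X                        ≤⟨ *-monoʳ-≤ 8 bernoulli ⟩
      8 * (L + 3 * (d * (c * c)))  ≡⟨ arith L d (c * c) ⟩
      8 * L + (24 * d) * (c * c)   ≤⟨ +-monoʳ-≤ (8 * L) (*-monoˡ-≤ (c * c) 24d≤c) ⟩
      8 * L + X                    ∎
      where
      arith : ∀ L d x → 8 * (L + 3 * (d * x)) ≡ 8 * L + (24 * d) * x
      arith = solve-∀

  U<L : U < L
  U<L = *-cancelˡ-< 32 U L (<-≤-trans (≤-<-trans upper 27X<28X) lower)
    where
    27X<28X : 27 * (c * (c * c)) < 28 * (c * (c * c))
    27X<28X = m<n+m (27 * (c * (c * c))) (*-mono-≤ c>0 (*-mono-≤ c>0 c>0))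

-- Triangles through the first three points

∑-cons : ∀ b (f : Subset (suc n) → ℕ) → ∑ (f ∘ (b ∷_)) ≤ ∑ f
∑-cons true  f = m≤m+n _ _
∑-cons false f = m≤n+m _ _

∑-prefix : ∀ x y z (f : Subset (3 + n) → ℕ) → ∑ (λ A → f (x ∷ y ∷ z ∷ A)) ≤ ∑ f
∑-prefix x y z f = ≤-trans (∑-cons z (λ A → f (x ∷ y ∷ A)))
  (≤-trans (∑-cons y (λ A → f (x ∷ A))) (∑-cons x f))

-- Fixing the point `i` leaves C(m-1,j-1) choices; this is relaxed to C(m,j-1), the form used in
-- `G`.
#-size-∋ : ∀ {m} (i : Fin m) j (P : Family m) → (∀ A → A ∈F P → ∣ A ∣ ≡ j × lookup A i ≡ true) →
  # P ≤ bin⁻ m j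
#-size-∋ i zero P h = ≤-reflexive (#-∅ none)
  where
  none : ∀ A → ¬ A ∈F P
  none A p = let s , iA = h A p in contradiction s (>⇒≢ (x∈p⇒0<∣p∣ (lookup⇒[]= i A iA)))
#-size-∋ {suc m} i (suc j) P h = ≤-trans (subst (λ s → # P ≤ bin s j)
    (trans (∣∁p∣≡n∸∣p∣ ⁅ i ⁆) (cong (suc m ∸_) (∣⁅x⁆∣≡1 i)))
    (#-supersets P ⁅ i ⁆ j λ A p → let s , iA = h A p in
      trans s (trans (+-comm 1 j) (cong (j +_) (sym (∣⁅x⁆∣≡1 i)))) , ⁅x⁆⊆A iA))
  (bin-monoˡ m j)

sized : ∀ {m} → ℕ → Family m
sized j A = ∣ A ∣ ≡ᵇ j

disjoint : ∀ {m} → Subset m → Family m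
disjoint A B = ∣ A ∩ B ∣ ≡ᵇ 0

-- From all sets of size `j`, those through some point of `A` are removed, by a union bound over its
-- `j` points.
#-disjoint : ∀ {m} j (A : Subset m) → ∣ A ∣ ≡ j → bin m j ∸ j * bin⁻ m j ≤ # (sized j ∩F disjoint A)
#-disjoint {m} j A ∣A∣ = m≤n+o⇒m∸n≤o (bin m j) (j * bin⁻ m j) (begin
  bin m j
    ≡⟨ sym (#-size m j) ⟩
  # (sized {m} j)
    ≡⟨ #-split (sized j) (disjoint A) ⟩
  # (sized j ∩F disjoint A) + # (sized j ∖F disjoint A)
    ≡⟨ +-comm (# (sized j ∩F disjoint A)) _ ⟩
  # (sized j ∖F disjoint A) + # (sized j ∩F disjoint A)
    ≤⟨ +-monoˡ-≤ _ (subst (λ s → # (sized j ∖F disjoint A) ≤ s * bin⁻ m j) ∣A∣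
         (#-union-bound (sized j ∖F disjoint A) A at bound meet)) ⟩
  j * bin⁻ m j + # (sized j ∩F disjoint A) ∎)
  where
  open ≤-Reasoning
  bound : ∀ i → lookup A i ≡ true → # (sized j ∖F disjoint A ∩F at i) ≤ bin⁻ m j
  bound i _ = #-size-∋ i j (sized j ∖F disjoint A ∩F at i) h
    where
    h : ∀ B → B ∈F (sized j ∖F disjoint A ∩F at i) → ∣ B ∣ ≡ j × lookup B i ≡ true
    h B p with ∧-true⁻ {(sized j ∖F disjoint A) B} p
    ... | q , iB = ≡ᵇ⁻ (proj₁ (∧-true⁻ {sized j B} q)) , iB
  meet : ∀ B → B ∈F (sized j ∖F disjoint A) → ∃ λ i → lookup A i ≡ true × lookup B i ≡ true
  meet B p with ∣ A ∩ B ∣ in eq | proj₂ (∧-true⁻ {sized j B} p)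
  ... | suc s | _ with 0<∣p∣⇒nonempty (A ∩ B) (subst (0 <_) (sym eq) (s≤s z≤n))
  ...   | i , q = let iA , iB = x∈p∩q⁻ A B q in i , []=⇒lookup iA , []=⇒lookup iB

ttf tft ftt : Subset n → Subset (3 + n)
ttf A = true ∷ true ∷ false ∷ A
tft A = true ∷ false ∷ true ∷ A
ftt A = false ∷ true ∷ true ∷ A

-- The three members get the three different pairs of the first three points, which have no common
-- point. Beyond these points it suffices that the tails of the first two are disjoint, so the third
-- is free; hence `M`, `G` and `M` choices.
ord-FX-lower : ∀ {k n} j m → k ≡ 2 + j → n ≡ 3 + m → let M = bin m j in
  M * ((M ∸ j * bin⁻ m j) * M) ≤ ord (FX (firsts n 3) k)
ord-FX-lower j m refl refl = begin
  M * (G * M)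
    ≡⟨ cong (_* (G * M)) (sym (#-size m j)) ⟩
  ∑ s * (G * M)
    ≡⟨ sym (∑-*ʳ (G * M) s) ⟩
  ∑ (λ A → s A * (G * M))
    ≤⟨ ∑-mono row ⟩
  ∑ (λ A → s A * (∑ (g A) * M))
    -- Unfolds the product back into sums, `M` being the number of choices for the third tail.
    ≡⟨ ∑-cong (λ A → trans (cong (s A *_) (sym (trans (∑-cong (λ B → trans (∑-*ˡ (g A B) s) (cong (g A B *_) (#-size m j)))) (∑-*ʳ M (g A)))))
         (sym (trans (∑-cong λ B → ∑-*ˡ (s A) (λ C → g A B * s C)) (∑-*ˡ (s A) (λ B → ∑ λ C → g A B * s C))))) ⟩
  ∑ (λ A → ∑ λ B → ∑ λ C → s A * (g A B * s C))
    ≤⟨ ∑-mono (λ A → ∑-mono λ B → ∑-mono λ C → pointwise A B C) ⟩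
  ∑ (λ A → ∑ λ B → ∑ λ C → f (ttf A) (tft B) (ftt C))
    ≤⟨ ∑-mono (λ A → ∑-mono λ B → ∑-prefix false true true (f (ttf A) (tft B))) ⟩
  ∑ (λ A → ∑ λ B → ∑ (f (ttf A) (tft B)))
    ≤⟨ ∑-mono (λ A → ∑-prefix true false true (λ B → ∑ (f (ttf A) B))) ⟩
  ∑ (λ A → ∑ λ B → ∑ (f (ttf A) B))
    ≤⟨ ∑-prefix true true false (λ A → ∑ λ B → ∑ (f A B)) ⟩
  ord Y ∎
  where
  open ≤-Reasoning
  M G : ℕ
  M = bin m j
  G = M ∸ j * bin⁻ m j
  Y : Family (3 + m)
  Y = FX (firsts (3 + m) 3) (2 + j)
  f : Subset (3 + m) → Subset (3 + m) → Subset (3 + m) → ℕ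
  f A B C = 𝟙 (isTriangle Y A B C)
  s : Subset m → ℕ
  s A = 𝟙 (sized j A)
  g : Subset m → Subset m → ℕ
  g A B = 𝟙 ((sized j ∩F disjoint A) B)
  row : ∀ A → s A * (G * M) ≤ s A * (∑ (g A) * M)
  row A with sized j A in eq
  ... | false = z≤n
  ... | true  = *-monoʳ-≤ 1 (*-monoˡ-≤ M (#-disjoint j A (≡ᵇ⁻ eq)))
  pointwise : ∀ A B C → s A * (g A B * s C) ≤ f (ttf A) (tft B) (ftt C)
  pointwise A B C = ≤-trans
    (≤-reflexive (sym (trans (𝟙-∧ (sized j A) _) (cong (s A *_) (𝟙-∧ ((sized j ∩F disjoint A) B) (sized j C))))))
    (𝟙-mono triangle)
    where
    triangle : sized j A ∧ ((sized j ∩F disjoint A) B ∧ sized j C) ≡ true →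
      isTriangle Y (ttf A) (tft B) (ftt C) ≡ true
    triangle p with ∧-true⁻ {sized j A} p
    ... | a , q with ∧-true⁻ {(sized j ∩F disjoint A) B} q
    ... | q′ , c with ∧-true⁻ {sized j B} q′
    ... | b , dis = isTriangle⁺ Y (ttf A) (tft B) (ftt C)
      (∧-true⁺ a refl) (∧-true⁺ b refl) (∧-true⁺ c refl)
      (n≤0⇒n≡0 (≤-trans (p⊆q⇒∣p∣≤∣q∣ {p = A ∩ B ∩ C} {A ∩ B} drop-C) (≤-reflexive (≡ᵇ⁻ dis))))
      where
      drop-C : A ∩ B ∩ C ⊆ A ∩ B
      drop-C x∈ = let xA , x∈′ = x∈p∩q⁻ A (B ∩ C) x∈ in x∈p∩q⁺ (xA , proj₁ (x∈p∩q⁻ B C x∈′))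

-- Completing a set to a triangle.

disjoint-of-size : (S : Subset n) (j : ℕ) → j + ∣ S ∣ ≤ n → ∃ λ T → ∣ T ∣ ≡ j × ∣ S ∩ T ∣ ≡ 0
disjoint-of-size [] zero h = [] , refl , refl
disjoint-of-size (true ∷ S) j h with disjoint-of-size S j (s≤s⁻¹ (≤-trans (≤-reflexive (sym (+-suc j (∣ S ∣)))) h))
... | T , p , q = false ∷ T , p , q
disjoint-of-size (false ∷ S) (suc j) (s≤s h) with disjoint-of-size S j h
... | T , p , q = true ∷ T , cong suc p , q
disjoint-of-size (false ∷ S) zero h with disjoint-of-size S 0 (∣A∣≤n S)
... | T , p , q = false ∷ T , p , q

∣A∩firsts0∣ : (A : Subset n) → ∣ A ∩ firsts n 0 ∣ ≡ 0
∣A∩firsts0∣ []          = refl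
∣A∩firsts0∣ (true ∷ A)  = ∣A∩firsts0∣ A
∣A∩firsts0∣ (false ∷ A) = ∣A∩firsts0∣ A

∣firsts∣ : ∀ n s → s ≤ n → ∣ firsts n s ∣ ≡ s
∣firsts∣ zero    zero    _       = refl
∣firsts∣ (suc n) zero    _       = ∣firsts∣ n zero z≤n
∣firsts∣ (suc n) (suc s) (s≤s h) = cong suc (∣firsts∣ n s h)

-- The companions take the other two pairs of the 3-set, both with the same tail `T` disjoint from
-- the tail of `A`; that alone empties the common intersection.
F'X-triangle₀ : ∀ {k n j m} → k ≡ 2 + j → n ≡ 3 + m → j + j ≤ m →
  ∀ A → A ∈F F'X (firsts n 3) k → ∃ λ B → ∃ λ C → isTriangle (FX (firsts n 3) k) A B C ≡ true
F'X-triangle₀ {j = j} {m} refl refl 2j≤m (x ∷ y ∷ z ∷ A) p with F'X⁻ {X = firsts (3 + m) 3} {2 + j} {x ∷ y ∷ z ∷ A} p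
... | s , h = cases x y z s h
  where
  Y : Family (3 + m)
  Y = FX (firsts (3 + m) 3) (2 + j)
  spare : ∣ A ∣ ≡ j → ∃ λ T → ∣ T ∣ ≡ j × ∣ A ∩ T ∩ T ∣ ≡ 0
  spare e with disjoint-of-size A j (subst (λ a → j + a ≤ m) (sym e) 2j≤m)
  ... | T , p , q = T , p , trans (cong (λ S → ∣ A ∩ S ∣) (∩-idem T)) q
  cases : ∀ x y z → ∣ x ∷ y ∷ z ∷ A ∣ ≡ 2 + j → ∣ (x ∷ y ∷ z ∷ A) ∩ firsts (3 + m) 3 ∣ ≡ 2 →
    ∃ λ B → ∃ λ C → isTriangle Y (x ∷ y ∷ z ∷ A) B C ≡ true
  cases true  true  false s h with spare (suc-injective (suc-injective s))
  ... | T , p , q = tft T , ftt T , isTriangle⁺ Y (ttf A) (tft T) (ftt T)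
    (∧-true⁺ (≡ᵇ⁺ s) refl) (∧-true⁺ (≡ᵇ⁺ p) refl) (∧-true⁺ (≡ᵇ⁺ p) refl) q
  cases true  false true  s h with spare (suc-injective (suc-injective s))
  ... | T , p , q = ttf T , ftt T , isTriangle⁺ Y (tft A) (ttf T) (ftt T)
    (∧-true⁺ (≡ᵇ⁺ s) refl) (∧-true⁺ (≡ᵇ⁺ p) refl) (∧-true⁺ (≡ᵇ⁺ p) refl) q
  cases false true  true  s h with spare (suc-injective (suc-injective s))
  ... | T , p , q = ttf T , tft T , isTriangle⁺ Y (ftt A) (ttf T) (tft T)
    (∧-true⁺ (≡ᵇ⁺ s) refl) (∧-true⁺ (≡ᵇ⁺ p) refl) (∧-true⁺ (≡ᵇ⁺ p) refl) q
  cases true  true  true  s h = contradiction (trans (sym (cong (3 +_) (∣A∩firsts0∣ A))) h) λ ()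
  cases true  false false s h = contradiction (trans (sym (cong (1 +_) (∣A∩firsts0∣ A))) h) λ ()
  cases false true  false s h = contradiction (trans (sym (cong (1 +_) (∣A∩firsts0∣ A))) h) λ ()
  cases false false true  s h = contradiction (trans (sym (cong (1 +_) (∣A∩firsts0∣ A))) h) λ ()
  cases false false false s h = contradiction (trans (sym (∣A∩firsts0∣ A)) h) λ ()

-- `X` is moved to the first three points, and the triangle found there is carried back by the
-- inverse permutation.
F'X-triangle : ∀ {k n j m} → k ≡ 2 + j → n ≡ 3 + m → j + j ≤ m →
  (X : Subset n) → ∣ X ∣ ≡ 3 → ∀ A → A ∈F F'X X k →
  ∃ λ B → ∃ λ C → isTriangle (FX X k) A B C ≡ true
F'X-triangle {k} {n} k≡ n≡ 2j≤m X hX A a with sort X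
... | p , sorted with F'X-triangle₀ k≡ n≡ 2j≤m (act p A) a₀
  where
  X₁ : act p X ≡ firsts n 3
  X₁ = trans sorted (cong (firsts n) hX)
  a₀ : act p A ∈F F'X (firsts n 3) k
  a₀ with F'X⁻ {X = X} {k} {A} a
  ... | s , t = F'X⁺ {X = firsts n 3} {k} {act p A} (trans (∣act∣ p A) s)
    (trans (cong (λ Y → ∣ act p A ∩ Y ∣) (sym X₁)) (trans (cong ∣_∣ (sym (act-∩ p A X))) (trans (∣act∣ p (A ∩ X)) t)))
... | B , C , t = act (inv p) B , act (inv p) C , back
  where
  open ≡-Reasoning
  Y : Family n
  Y = FX (firsts n 3) k
  B′ C′ : Subset n
  B′ = act (inv p) B
  C′ = act (inv p) C
  pull : isTriangle (Y ∘ act p) A B′ C′ ≡ true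
  pull = begin
    isTriangle (Y ∘ act p) A B′ C′
      ≡⟨ isTriangle-act p Y A B′ C′ ⟩
    isTriangle Y (act p A) (act p B′) (act p C′)
      ≡⟨ cong₂ (isTriangle Y (act p A)) (act-inv p B) (act-inv p C) ⟩
    isTriangle Y (act p A) B C
      ≡⟨ t ⟩
    true ∎
  back : isTriangle (FX X k) A B′ C′ ≡ true
  back = isTriangle-⊆ {F = Y ∘ act p} {FX X k} (λ D d → trans (sym (FX-act p X k D))
    (trans (cong (λ Z → FX Z k (act p D)) (trans sorted (cong (firsts n) hX))) d)) A B′ C′ pull

-- The bound and the case of equality.

module Main {k n j m : ℕ} (k≡ : k ≡ 2 + j) (n≡ : n ≡ 3 + m) (large : 4 * k ^ 6 ≤ 3 + m)
  (F : Family n) (uniform : IsKUniform k F) (intersecting : Intersecting F) where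

  open Numerics k j m k≡ large using (U<L; 2j≤m; U; r; t)
  open Bounds k≡ n≡ F uniform intersecting

  3≤n : 3 ≤ n
  3≤n = subst (3 ≤_) (sym n≡) (m≤m+n 3 m)

  X₀≡ : X₀ n ≡ firsts n 3
  X₀≡ = subst (λ n → X₀ n ≡ firsts n 3) (sym n≡) (X₀-firsts m)

  Y : Family n
  Y = FX (firsts n 3) k

  ∣X₀∣ : ∣ X₀ n ∣ ≡ 3
  ∣X₀∣ = trans (cong ∣_∣ X₀≡) (∣firsts∣ n 3 3≤n)

  ord-n3 : ord Y ≡ 6 * n3 n k
  ord-n3 = trans (cong (λ X → ord (FX X k)) (sym X₀≡))
    (ord≡6*triangles (FX (X₀ n) k) (FX-intersecting (X₀ n) k ∣X₀∣))

  ord-F : ord F ≡ 6 * triangles F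
  ord-F = ord≡6*triangles F intersecting

  ord-X : ∀ X → ∣ X ∣ ≡ 3 → ord (FX X k) ≡ ord Y
  ord-X X hX with sort X
  ... | p , eq = trans (ord-FX p X k) (cong (λ Z → ord (FX Z k)) (trans eq (cong (firsts n) hX)))

  U<ordY : U < ord Y
  U<ordY = <-≤-trans U<L (ord-FX-lower j m k≡ n≡)

  Avoid : Fin n → Set
  Avoid x = ∃ λ A → A ∈F F × lookup A x ≡ false

  avoid? : ∀ x → Dec (Avoid x)
  avoid? x = anySubset? λ A → (F A Bool.≟ true) ×-dec (lookup A x Bool.≟ false)

  -- Members through `x` number at most `k * c₂` and the rest at most `t`, together `r`; so
  -- `ord-bound` gives `U`.
  few-missing⇒ord< : (∀ x → Avoid x) → ∀ x → # (F ∖F at x) ≤ t → ord F < ord Y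
  few-missing⇒ord< avoid x few = ≤-<-trans ord≤U U<ordY
    where
    open Avoidable avoid
    #F≤r : # F ≤ r
    #F≤r = ≤-trans (≤-reflexive (#-split F (at x))) (+-mono-≤ (deg-bound x) few)
    ord≤U : ord F ≤ U
    ord≤U = ≤-trans (ord-bound x) (*-monoʳ-≤ 3
      (*-mono-≤ {# (F ∖F at x)} {t} {# F * # F} {r * r} few (*-mono-≤ {# F} {r} {# F} {r} #F≤r #F≤r)))

  dichotomy : (∃ λ X → ∣ X ∣ ≡ 3 × F ⊆F FX X k) ⊎ ord F < ord Y
  dichotomy with any? (λ x → ¬? (avoid? x))
  ... | yes (x , ¬avoid) = inj₂ (subst (_< ord Y) (sym (∀∋⇒ord≡0 x all)) (≤-<-trans z≤n U<ordY))
    where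
    all : F ⊆F at x
    all A a with lookup A x in eq
    ... | true  = refl
    ... | false = contradiction (A , a , eq) ¬avoid
  ... | no ¬∃ = from-structure (Avoidable.structure avoid (subst Fin (sym n≡) zero))
    where
    avoid : ∀ x → Avoid x
    avoid x = decidable-stable (avoid? x) λ ¬a → ¬∃ (x , ¬a)
    from-structure : (∃ λ x → # (F ∖F at x) ≤ t) ⊎ (∃ λ X → ∣ X ∣ ≡ 3 × F ⊆F FX X k) →
      (∃ λ X → ∣ X ∣ ≡ 3 × F ⊆F FX X k) ⊎ ord F < ord Y
    from-structure (inj₁ (x , few)) = inj₂ (few-missing⇒ord< avoid x few)
    from-structure (inj₂ X)         = inj₁ X

  ord-≤ : ord F ≤ ord Y
  ord-≤ with dichotomy
  ... | inj₂ lt           = <⇒≤ lt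
  ... | inj₁ (X , hX , s) = subst (ord F ≤_) (ord-X X hX) (ord-⊆ {F = F} {FX X k} s)

  Extremal : Set
  Extremal = Σ (Subset n) (λ X → (∣ X ∣ ≡ 3) × (F'X X k ⊆F F) × (F ⊆F FX X k))

  -- Equality rules out the strict alternative. A missing member of `F'X X k` would then cost a
  -- triangle of `FX X k` and make the count strictly smaller.
  extremal : ord F ≡ ord Y → Extremal
  extremal eq with dichotomy
  ... | inj₂ lt           = contradiction eq (<⇒≢ lt)
  ... | inj₁ (X , hX , s) = X , hX , contains , s
    where
    ¬missing : ∀ A → A ∈F F'X X k → ¬ F A ≡ false
    ¬missing A a FA = let B , C , t = F'X-triangle k≡ n≡ 2j≤m X hX A a in
      <-irrefl (trans eq (sym (ord-X X hX))) (ord-⊂ {F = F} {FX X k} s {A} {B} {C} t FA)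
    contains : F'X X k ⊆F F
    contains A a with F A in FA
    ... | true  = refl
    ... | false = contradiction FA (¬missing A a)

  -- All triangles of `FX X k` already lie in `F'X X k`, so any family between the two has the same
  -- ones.
  extremal⇒≡ : Extremal → ord F ≡ ord Y
  extremal⇒≡ (X , hX , s′ , s) = trans (≤-antisym (ord-⊆ {F = F} {FX X k} s) FX≤F) (ord-X X hX)
    where
    FX≤F : ord (FX X k) ≤ ord F
    FX≤F = ord-mono (FX X k) F λ A B C t →
      isTriangle-⊆ {F = F'X X k} {F} s′ A B C (FX-triangle⇒F'X X k hX A B C t)

  result : (triangles F ≤ n3 n k) × (triangles F ≡ n3 n k ⇔ Extremal)
  result = *-cancelˡ-≤ 6 (subst₂ _≤_ ord-F ord-n3 ord-≤) ,
    mk⇔ (λ eq → extremal (trans ord-F (trans (cong (6 *_) eq) (sym ord-n3))))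
        (λ ex → *-cancelˡ-≡ _ _ 6 (trans (sym ord-F) (trans (extremal⇒≡ ex) ord-n3)))

theorem1 : (k n : ℕ) → 2 ≤ k → 4 * k ^ 6 ≤ n →
    (F : Family n) → IsKUniform k F → Intersecting F →
    (triangles F ≤ n3 n k)
    × (triangles F ≡ n3 n k ⇔
    Σ (Subset n) (λ X → (∣ X ∣ ≡ 3) × (F'X X k ⊆F F) × (F ⊆F FX X k)))
theorem1 k n 2≤k large = Main.result {j = k ∸ 2} {m = n ∸ 3}
  (sym (m+[n∸m]≡n 2≤k)) (sym 3+m≡n) (≤-trans large (≤-reflexive (sym 3+m≡n)))
  where
  -- Ensures that the truncated `n ∸ 3` is a true difference.
  3≤4k⁶ : 3 ≤ 4 * k ^ 6
  3≤4k⁶ = ≤-trans (m≤m+n 3 1) (*-monoʳ-≤ 4 (m^n>0 k {{>-nonZero (≤-trans (s≤s z≤n) 2≤k)}} 6))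
  3+m≡n : 3 + (n ∸ 3) ≡ n
  3+m≡n = m+[n∸m]≡n (≤-trans 3≤4k⁶ large)
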